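{- For every integer $r\ge 2$ there exist a finite family $\mathcal{F}$ of $r$-graphs and a constant $k\in\mathbb{N}$ such that $$\operatorname{sat}(\mathcal{F},n)=\begin{cases} O(n) & \text{if } k\mid n,\\ \Omega\left(n^{r-1}\right) & \text{if } k\nmid n.\end{cases}$$ In particular, for any $l\in\{1,2,\ldots,r-1\}$, the sequence $\frac{\operatorname{sat}(\mathcal{F},n)}{n^{l}}$ does not converge as $n\to\infty$.
   Context: An $r$-graph $H$ is a pair $(V(H),E(H))$ where $V(H)$ is a finite set of vertices and the edge set $E(H)$ is a collection of $r$-element subsets of $V(H)$. Write $|H|=|V(H)|$ and $e(H)=|E(H)|$. Containment of one $r$-graph in another as a subgraph means containing a (not necessarily induced) copy of it. For a family $\mathcal{F}$ of $r$-graphs, an $r$-graph $H$ is called $\mathcal{F}$-saturated if it does not contain any graph in $\mathcal{F}$ as a subgraph, but adding any extra edge (that is, any $r$-element subset of $V(H)$ not in $E(H)$) to $H$ creates a copy of some graph $F\in\mathcal{F}$ as a subgraph. The saturation number is $$\operatorname{sat}(\mathcal{F},n)=\min\{e(H): |H|=n \text{ and } H \text{ is } \mathcal{F}\text{ -saturated}\}.$$ The notations $O(\cdot)$ and $\Omega(\cdot)$ are asymptotic as $n\to\infty$ along the indicated values of $n$ (multiples of $k$, respectively non-multiples of $k$), with $r$, $k$ and $\mathcal{F}$ fixed. -}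

module Defs where

open import Data.Bool.Base using (if_then_else_)
open import Data.Fin.Base using (Fin; zero; suc)
open import Data.Fin.Subset using (Subset; ⊥; ⁅_⁆; _∪_; ∣_∣)
open import Data.Integer.Base using (+_)
open import Data.List.Base using (List; _∷_; length)
open import Data.List.Membership.Propositional using (_∈_; _∉_)
open import Data.List.Relation.Unary.All using (All; _∷_)
open import Data.List.Relation.Unary.All.Properties using (¬Any⇒All¬)
open import Data.List.Relation.Unary.AllPairs using (_∷_)
open import Data.List.Relation.Unary.Unique.Propositional using (Unique)
open import Data.Nat.Base using (ℕ; suc; _*_; _^_; _≤_)
open import Data.Nat.Properties using (m^n≢0)
open import Data.Product.Base using (Σ; ∃; _×_; proj₂)
open import Data.Rational.Base as ℚ using (ℚ)
open import Data.Sum.Base using (_⊎_)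
open import Data.Vec.Base using ([]; _∷_)
open import Function.Base using (_∘_)
open import Function.Bundles using (_⇔_; _↣_; Injection)
open import Level using (0ℓ)
open import Relation.Binary.PropositionalEquality using (_≡_)
open import Relation.Nullary.Negation using (¬_)
open import Relation.Unary using (Pred)

-- The vertex set is Fin n. The edge list carries an irrelevant order, but no
-- repetitions, so its length is the number of edges.
record Hypergraph (r n : ℕ) : Set where
  field
    edges   : List (Subset n)
    uniform : All (λ e → ∣ e ∣ ≡ r) edges
    unique  : Unique edges

open Hypergraph public

∥_∥ : ∀ {r n} → Hypergraph r n → ℕ
∥ H ∥ = length (edges H)

addEdge : ∀ {r n} (H : Hypergraph r n) (e : Subset n) →
          ∣ e ∣ ≡ r → e ∉ edges H → Hypergraph r n
addEdge H e ∣e∣≡r e∉H = record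
  { edges   = e ∷ edges H
  ; uniform = ∣e∣≡r ∷ uniform H
  ; unique  = ¬Any⇒All¬ (edges H) e∉H ∷ unique H
  }

image : ∀ {m n} → (Fin m → Fin n) → Subset m → Subset n
image f []      = ⊥
image f (s ∷ p) = (if s then ⁅ f zero ⁆ else ⊥) ∪ image (f ∘ suc) p

infix 4 _⊑_

-- H contains a not necessarily induced copy of F.
_⊑_ : ∀ {r m n} → Hypergraph r m → Hypergraph r n → Set
_⊑_ {m = m} {n} F H = Σ (Fin m ↣ Fin n) λ f →
  ∀ {e} → e ∈ edges F → image (Injection.to f) e ∈ edges H

Family : ℕ → Set
Family r = List (∃ (Hypergraph r))

record Saturated {r n : ℕ} (𝓕 : Family r) (H : Hypergraph r n) : Set where
  field
    free    : ∀ {F} → F ∈ 𝓕 → ¬ (proj₂ F ⊑ H)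
    maximal : ∀ e (∣e∣≡r : ∣ e ∣ ≡ r) (e∉H : e ∉ edges H) →
              ∃ λ F → F ∈ 𝓕 × proj₂ F ⊑ addEdge H e ∣e∣≡r e∉H

record IsSaturationNumber {r : ℕ} (𝓕 : Family r) (n s : ℕ) : Set where
  field
    attained : Σ (Hypergraph r n) λ H → Saturated 𝓕 H × ∥ H ∥ ≡ s
    minimum  : ∀ (H : Hypergraph r n) → Saturated 𝓕 H → s ≤ ∥ H ∥

-- f(n) = O(g(n)) as n → ∞ along the n satisfying P. Natural-number constants
-- suffice, since any real constant may be rounded up.
BigO : Pred ℕ 0ℓ → (f g : ℕ → ℕ) → Set
BigO P f g = ∃ λ C → ∃ λ N → ∀ n → N ≤ n → P n → f n ≤ C * g n

BigΩ : Pred ℕ 0ℓ → (f g : ℕ → ℕ) → Set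
BigΩ P f g = BigO P g f

-- Real numbers as two-sided Dedekind cuts: lower q means q < x, and
-- upper q means x < q.
record ℝ : Set₁ where
  field
    lower upper     : Pred ℚ 0ℓ
    lower-inhabited : ∃ lower
    upper-inhabited : ∃ upper
    lower-rounded   : ∀ p → lower p ⇔ ∃ λ q → p ℚ.< q × lower q
    upper-rounded   : ∀ q → upper q ⇔ ∃ λ p → p ℚ.< q × upper p
    disjoint        : ∀ q → ¬ (lower q × upper q)
    located         : ∀ p q → p ℚ.< q → lower p ⊎ upper q

open ℝ public

Eventually : Pred ℕ 0ℓ → Set
Eventually P = ∃ λ N → ∀ n → N ≤ n → P n

infix 4 _⟶_

-- Every open interval with rational endpoints around x contains all but
-- finitely many terms of a.
_⟶_ : (ℕ → ℚ) → ℝ → Set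
a ⟶ x = (∀ p → lower x p → Eventually (λ n → p ℚ.< a n))
      × (∀ q → upper x q → Eventually (λ n → a n ℚ.< q))

Convergent : (ℕ → ℚ) → Set₁
Convergent a = ∃ λ x → a ⟶ x

-- The sequence s(n) / nˡ for n ≥ 1, indexed from 0 to avoid dividing by zero.
ratio : (s : ℕ → ℕ) (l : ℕ) → ℕ → ℚ
ratio s l i = (+ s (suc i)) ℚ./ (suc i ^ l)
  where instance _ = m^n≢0 (suc i) l

{-# OPTIONS --safe #-}
module Submission where

-- Put k = r + 2. In an r-graph call a k-set of vertices a clique if all its
-- r-subsets are edges, and call a vertex covered if it lies in a clique. The
-- r-graph is obstructed if some edge, all of whose vertices are covered, meets
-- a clique without being contained in it. An obstruction is witnessed by at
-- most r + 1 cliques, so the obstructed r-graphs on at most (r + 1) k vertices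
-- form a finite family, and an r-graph contains a member of the family exactly
-- when it is obstructed (contains⇒obstructed, obstructed⇒contains).
--
-- In an unobstructed r-graph distinct cliques are disjoint (cliques-disjoint),
-- and every edge outside the cliques contains an uncovered vertex.
--
-- If k divides n, the disjoint union of n / k cliques is saturated: a new edge
-- has only covered vertices and lies in no clique. It has O(n) edges
-- (sat-multiple).
--
-- If k does not divide n, the cliques of a saturated r-graph cannot partition
-- the vertices, so some vertex v is uncovered (∤⇒uncovered). Adding a missing
-- edge e through v creates an obstruction, and as v was uncovered this is only
-- possible if e lies in a new clique (completes-clique). Since k > r, it follows
-- that every set T of r - 1 vertices lies in an edge: extend T and v to an
-- r-set e; if e is missing, any vertex w of the new clique outside e extends T
-- to an edge within that clique (small⊆edge). A family of r-sets covering all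
-- (r - 1)-sets has at least (n / r) ^ (r - 1) members (covering⇒≤), whence
-- Ω(n ^ (r - 1)) edges (sat-nonmultiple).
--
-- For r ≥ 3 the two bounds already prevent sat(n) / n ^ l from converging
-- (bounds⇒¬convergent). For r = 2 both are linear and the constants have to be
-- compared. Here k = 4, and sat(n) ≤ (24 / 16) n when 4 divides n. Otherwise
-- sat(n) ≥ (25 / 16) n for large n. Indeed, if some uncovered v has degree at
-- most n / 8, then each vertex w that is not adjacent to v has two common
-- neighbours with v, because the edge vw would complete a clique; this gives
-- about 2 (7 / 8) n edges (Sparse). If all uncovered vertices have degree at
-- least n / 8, fix one, v: every vertex has degree at least 3, and at least 4
-- if it is adjacent to v, so the degree sum is at least 3 n + n / 8 (dense).

open import Defs
open import Data.Bool.Base using (true; false; if_then_else_)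
open import Data.Bool.Properties using () renaming (_≟_ to _≟ᵇ_)
open import Data.Fin.Base using (Fin; zero; suc; combine)
open import Data.Fin.Properties
  using (injective⇒≤; suc-injective; ¬∀⟶∃¬; any?; all?;
         combine-injectiveˡ; combine-injectiveʳ; combine-surjective)
  renaming (_≟_ to _≟ᶠ_)
open import Data.Fin.Subset using (Subset; inside; outside; ⊥; ⊤; ⁅_⁆; _∪_; _∩_; ∣_∣)
  renaming (_∈_ to _∈ˢ_; _∉_ to _∉ˢ_; _⊆_ to _⊆ˢ_)
open import Data.Fin.Subset.Properties
import Data.Integer.Base as ℤ
import Data.Integer.Properties as ℤ
open import Data.List.Base
  using (List; []; _∷_; _++_; length; map; filter; concatMap; allFin; lookup; upTo; deduplicate)
import Data.List.Membership.DecPropositional as DecMembership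
open import Data.List.Membership.Propositional using (_∈_; _∉_; find; lose)
open import Data.List.Membership.Propositional.Properties
open import Data.List.Properties
  using (length-map; length-++; length-tabulate; length-deduplicate)
open import Data.List.Relation.Binary.Subset.Propositional using (_⊆_)
open import Data.List.Relation.Unary.All as All using ([]; _∷_)
open import Data.List.Relation.Unary.All.Properties using (all-filter; ¬Any⇒All¬)
open import Data.List.Relation.Unary.AllPairs using ([]; _∷_)
open import Data.List.Relation.Unary.Any using (here; there; index)
open import Data.List.Relation.Unary.Any.Properties using (lookup-index)
open import Data.List.Relation.Unary.Unique.DecPropositional.Properties using (deduplicate-!)
open import Data.List.Relation.Unary.Unique.Propositional using (Unique)
import Data.List.Relation.Unary.Unique.Propositional.Properties as Unique
open import Data.Nat.Base
  using (ℕ; zero; suc; pred; _+_; _*_; _∸_; _^_; _≤_; _<_; z≤n; s≤s; s≤s⁻¹; NonZero; >-nonZero)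
open import Data.Nat.Divisibility using (_∣_; _∤_; divides; ∣m+n∣m⇒∣n; ∣⇒≤; n∣m*n)
open import Data.Nat.ListAction using () renaming (sum to sumᴸ)
open import Data.Nat.Properties as ℕ using (+-0-commutativeMonoid)
open import Data.Nat.Solver using (module +-*-Solver)
open import Data.Product.Base using (Σ; ∃; _×_; _,_; proj₁; proj₂)
import Data.Rational.Base as ℚ
import Data.Rational.Properties as ℚ
import Data.Rational.Unnormalised.Base as ℚᵘ
import Data.Rational.Unnormalised.Properties as ℚᵘ
open import Data.Sum.Base using (_⊎_; inj₁; inj₂)
open import Data.Vec.Base as Vec using ([]; _∷_; here; there)
open import Data.Vec.Properties
  using (≡-dec; ∷-injectiveʳ; lookup∘tabulate; []=⇒lookup; lookup⇒[]=)
open import Function.Base using (_∘_; id)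
open import Function.Bundles using (_↣_; Injection; mk↣)
open import Level using (0ℓ)
open import Relation.Binary.Definitions using (DecidableEquality)
open import Relation.Binary.PropositionalEquality
open import Relation.Nullary.Decidable
  using (Dec; yes; no; does; _×-dec_; _→-dec_; ¬?; map′; dec-true; decidable-stable)
open import Relation.Nullary.Negation using (¬_; contradiction)
open import Relation.Unary using (Pred; Decidable)
open import Algebra.Properties.CommutativeMonoid.Sum +-0-commutativeMonoid
  using (sum; sum-cong-≗; ∑-distrib-+; sum-replicate-zero)
open import Data.List.Extrema ℕ.≤-totalOrder
  using (argmin; argmax; argmin-all; argmax-all; f[xs]≤f[argmax]; f[argmin]≤f[xs])
open +-*-Solver using (solve; con; _:+_; _:*_; _:=_)

private
  variable
    A : Set
    m n : ℕ

-- Lists without repetitions, and enumeration of sublists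

lookup-injective : {xs : List A} → Unique xs → ∀ {i j} → lookup xs i ≡ lookup xs j → i ≡ j
lookup-injective (_ ∷ _)      {zero}  {zero}  _  = refl
lookup-injective {xs = _ ∷ xs} (x∉ ∷ _) {zero} {suc j} eq =
  contradiction eq (All.lookup x∉ (∈-lookup {xs = xs} j))
lookup-injective {xs = _ ∷ xs} (x∉ ∷ _) {suc i} {zero} eq =
  contradiction (sym eq) (All.lookup x∉ (∈-lookup {xs = xs} i))
lookup-injective (_ ∷ xs!)    {suc i} {suc j} eq = cong suc (lookup-injective xs! eq)

unique⇒length≤ : {xs ys : List A} → Unique xs → xs ⊆ ys → length xs ≤ length ys
unique⇒length≤ {xs = xs} {ys} xs! xs⊆ys = injective⇒≤ {f = position} position-injective
  where
  position : Fin (length xs) → Fin (length ys)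
  position i = index (xs⊆ys (∈-lookup {xs = xs} i))

  lookup-position : ∀ i → lookup xs i ≡ lookup ys (position i)
  lookup-position i = lookup-index (xs⊆ys (∈-lookup {xs = xs} i))

  position-injective : ∀ {i j} → position i ≡ position j → i ≡ j
  position-injective {i} {j} eq = lookup-injective xs!
    (trans (lookup-position i) (trans (cong (lookup ys) eq) (sym (lookup-position j))))

-- The default d does not have to be an element of xs.
argmin-least : (f : A → ℕ) (d : A) (xs : List A) {x : A} → x ∈ xs → f (argmin f d xs) ≤ f x
argmin-least f d xs = All.lookup (f[argmin]≤f[xs] {f = f} d xs)

argmax-greatest : (f : A → ℕ) (d : A) (xs : List A) {x : A} → x ∈ xs → f x ≤ f (argmax f d xs)
argmax-greatest f d xs = All.lookup (f[xs]≤f[argmax] {f = f} d xs)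

sublists : List A → List (List A)
sublists []       = [] ∷ []
sublists (x ∷ xs) = map (x ∷_) (sublists xs) ++ sublists xs

filter∈sublists : {P : Pred A 0ℓ} (P? : Decidable P) (xs : List A) → filter P? xs ∈ sublists xs
filter∈sublists P? []       = here refl
filter∈sublists P? (x ∷ xs) with does (P? x)
... | true  = ∈-++⁺ˡ (∈-map⁺ (x ∷_) (filter∈sublists P? xs))
... | false = ∈-++⁺ʳ (map (x ∷_) (sublists xs)) (filter∈sublists P? xs)

-- Subsets of a finite set

∣p∪q∣≤∣p∣+∣q∣ : (p q : Subset n) → ∣ p ∪ q ∣ ≤ ∣ p ∣ + ∣ q ∣
∣p∪q∣≤∣p∣+∣q∣ []            []            = z≤n
∣p∪q∣≤∣p∣+∣q∣ (outside ∷ p) (outside ∷ q) = ∣p∪q∣≤∣p∣+∣q∣ p q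
∣p∪q∣≤∣p∣+∣q∣ (inside  ∷ p) (outside ∷ q) = s≤s (∣p∪q∣≤∣p∣+∣q∣ p q)
∣p∪q∣≤∣p∣+∣q∣ (outside ∷ p) (inside  ∷ q) =
  ℕ.≤-trans (s≤s (∣p∪q∣≤∣p∣+∣q∣ p q)) (ℕ.≤-reflexive (sym (ℕ.+-suc ∣ p ∣ ∣ q ∣)))
∣p∪q∣≤∣p∣+∣q∣ (inside  ∷ p) (inside  ∷ q) =
  s≤s (ℕ.≤-trans (∣p∪q∣≤∣p∣+∣q∣ p q) (ℕ.+-monoʳ-≤ ∣ p ∣ (ℕ.n≤1+n ∣ q ∣)))

∣⁅x⁆∪p∣≤1+∣p∣ : (x : Fin n) (p : Subset n) → ∣ ⁅ x ⁆ ∪ p ∣ ≤ suc ∣ p ∣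
∣⁅x⁆∪p∣≤1+∣p∣ x p = ℕ.≤-trans (∣p∪q∣≤∣p∣+∣q∣ ⁅ x ⁆ p) (ℕ.≤-reflexive (cong (_+ ∣ p ∣) (∣⁅x⁆∣≡1 x)))

x∈⁅x⁆∪p : (x : Fin n) (p : Subset n) → x ∈ˢ ⁅ x ⁆ ∪ p
x∈⁅x⁆∪p x p = p⊆p∪q {p = ⁅ x ⁆} p (x∈⁅x⁆ x)

⁅x⁆∪p⊆q : {x : Fin n} {p q : Subset n} → x ∈ˢ q → p ⊆ˢ q → ⁅ x ⁆ ∪ p ⊆ˢ q
⁅x⁆∪p⊆q {x = x} {p} x∈q p⊆q y∈ with x∈p∪q⁻ ⁅ x ⁆ p y∈
... | inj₁ y∈⁅x⁆ with refl ← x∈⁅y⁆⇒x≡y x y∈⁅x⁆ = x∈q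
... | inj₂ y∈p   = p⊆q y∈p

⊆∧∣∣≥⇒≡ : {p q : Subset n} → p ⊆ˢ q → ∣ q ∣ ≤ ∣ p ∣ → p ≡ q
⊆∧∣∣≥⇒≡ {p = p} {q} p⊆q ∣q∣≤∣p∣ = ⊆-antisym p⊆q q⊆p
  where
  q⊆p : q ⊆ˢ p
  q⊆p {x} x∈q with x ∈? p
  ... | yes x∈p = x∈p
  ... | no  x∉p = contradiction (p⊂q⇒∣p∣<∣q∣ (p⊆q , x , x∈q , x∉p)) (ℕ.≤⇒≯ ∣q∣≤∣p∣)

∣∣<⇒∃∉ : {p q : Subset n} → ∣ p ∣ < ∣ q ∣ → ∃ λ x → x ∈ˢ q × x ∉ˢ p
∣∣<⇒∃∉ {p = p} {q} ∣p∣<∣q∣ with any? (λ x → (x ∈? q) ×-dec ¬? (x ∈? p))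
... | yes found = found
... | no  ∄     = contradiction (p⊆q⇒∣p∣≤∣q∣ q⊆p) (ℕ.<⇒≱ ∣p∣<∣q∣)
  where
  q⊆p : q ⊆ˢ p
  q⊆p {x} x∈q = decidable-stable (x ∈? p) (λ x∉p → ∄ (x , x∈q , x∉p))

-- Between nested sets there are sets of every intermediate size.
interpolate : {p q : Subset n} {j : ℕ} → p ⊆ˢ q → ∣ p ∣ ≤ j → j ≤ ∣ q ∣ →
              ∃ λ s → p ⊆ˢ s × s ⊆ˢ q × ∣ s ∣ ≡ j
interpolate {p = []} {[]} _ _ z≤n = [] , id , id , refl
interpolate {p = inside ∷ p} {outside ∷ q} p⊆q _ _ with () ← p⊆q here
interpolate {p = outside ∷ p} {outside ∷ q} p⊆q lo hi
  with s , p⊆s , s⊆q , ∣s∣≡j ← interpolate (drop-∷-⊆ p⊆q) lo hi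
  = outside ∷ s , s⊆s p⊆s , s⊆s s⊆q , ∣s∣≡j
interpolate {p = inside ∷ p} {inside ∷ q} p⊆q (s≤s lo) (s≤s hi)
  with s , p⊆s , s⊆q , ∣s∣≡j ← interpolate (drop-∷-⊆ p⊆q) lo hi
  = inside ∷ s , s⊆s p⊆s , s⊆s s⊆q , cong suc ∣s∣≡j
interpolate {p = outside ∷ p} {inside ∷ q} {j} p⊆q lo hi with j ℕ.≤? ∣ q ∣
... | no  j≰∣q∣ = inside ∷ q , p⊆q , id , ℕ.≤-antisym (ℕ.≰⇒> j≰∣q∣) hi
... | yes j≤∣q∣
  with s , p⊆s , s⊆q , ∣s∣≡j ← interpolate (drop-∷-⊆ p⊆q) lo j≤∣q∣
  = outside ∷ s , s⊆s p⊆s , out⊆ s⊆q , ∣s∣≡j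

-- The subset of the vertices satisfying a decidable predicate.
⟦_⟧ : {P : Pred (Fin n) 0ℓ} → Decidable P → Subset n
⟦ P? ⟧ = Vec.tabulate (λ x → does (P? x))

module _ {P : Pred (Fin n) 0ℓ} (P? : Decidable P) {x : Fin n} where

  ∈-⟦⟧⁺ : P x → x ∈ˢ ⟦ P? ⟧
  ∈-⟦⟧⁺ Px = lookup⇒[]= x _ (trans (lookup∘tabulate _ x) (dec-true (P? x) Px))

  ∈-⟦⟧⁻ : x ∈ˢ ⟦ P? ⟧ → P x
  ∈-⟦⟧⁻ x∈ with P? x | trans (sym (lookup∘tabulate (λ x → does (P? x)) x)) ([]=⇒lookup x∈)
  ... | yes Px | _ = Px

elements : Subset n → List (Fin n)
elements []            = []
elements (inside  ∷ p) = zero ∷ map suc (elements p)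
elements (outside ∷ p) = map suc (elements p)

length-elements : (p : Subset n) → length (elements p) ≡ ∣ p ∣
length-elements []            = refl
length-elements (inside  ∷ p) = cong suc (trans (length-map suc (elements p)) (length-elements p))
length-elements (outside ∷ p) = trans (length-map suc (elements p)) (length-elements p)

∈-elements⁺ : {x : Fin n} (p : Subset n) → x ∈ˢ p → x ∈ elements p
∈-elements⁺ (inside  ∷ p) here        = here refl
∈-elements⁺ (inside  ∷ p) (there x∈p) = there (∈-map⁺ suc (∈-elements⁺ p x∈p))
∈-elements⁺ (outside ∷ p) (there x∈p) = ∈-map⁺ suc (∈-elements⁺ p x∈p)

∈-elements⁻ : {x : Fin n} (p : Subset n) → x ∈ elements p → x ∈ˢ p
∈-elements⁻ (inside  ∷ p) (here refl) = here
∈-elements⁻ (inside  ∷ p) (there x∈)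
  with y , y∈ , refl ← ∈-map⁻ suc x∈ = there (∈-elements⁻ p y∈)
∈-elements⁻ (outside ∷ p) x∈
  with y , y∈ , refl ← ∈-map⁻ suc x∈ = there (∈-elements⁻ p y∈)

elements-unique : (p : Subset n) → Unique (elements p)
elements-unique []            = []
elements-unique (inside  ∷ p) =
  ¬Any⇒All¬ _ (λ 0∈ → 0∉map-suc (∈-map⁻ suc 0∈)) ∷ Unique.map⁺ suc-injective (elements-unique p)
  where
  0∉map-suc : ¬ (∃ λ y → y ∈ elements p × zero ≡ suc y)
  0∉map-suc (_ , _ , ())
elements-unique (outside ∷ p) = Unique.map⁺ suc-injective (elements-unique p)

-- The set of the two vertices x and y. It is a singleton if they coincide.
pair : Fin n → Fin n → Subset n
pair x y = ⁅ x ⁆ ∪ ⁅ y ⁆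

∈-pairˡ : (x y : Fin n) → x ∈ˢ pair x y
∈-pairˡ x y = x∈⁅x⁆∪p x ⁅ y ⁆

∈-pairʳ : (x y : Fin n) → y ∈ˢ pair x y
∈-pairʳ x y = q⊆p∪q ⁅ x ⁆ ⁅ y ⁆ (x∈⁅x⁆ y)

∈-pair⁻ : {x y z : Fin n} → z ∈ˢ pair x y → z ≡ x ⊎ z ≡ y
∈-pair⁻ {x = x} {y} z∈ with x∈p∪q⁻ ⁅ x ⁆ ⁅ y ⁆ z∈
... | inj₁ z∈x = inj₁ (x∈⁅y⁆⇒x≡y x z∈x)
... | inj₂ z∈y = inj₂ (x∈⁅y⁆⇒x≡y y z∈y)

pair⊆ : {x y : Fin n} {p : Subset n} → x ∈ˢ p → y ∈ˢ p → pair x y ⊆ˢ p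
pair⊆ {y = y} {p} x∈p y∈p = ⁅x⁆∪p⊆q x∈p λ z∈ → subst (_∈ˢ p) (sym (x∈⁅y⁆⇒x≡y y z∈)) y∈p

pair-comm : (x y : Fin n) → pair x y ≡ pair y x
pair-comm x y = ∪-comm ⁅ x ⁆ ⁅ y ⁆

pair-injective : (x : Fin n) {y z : Fin n} → pair x y ≡ pair x z → y ≡ z
pair-injective x {y} {z} eq with ∈-pair⁻ {x = x} (subst (y ∈ˢ_) eq (∈-pairʳ x y))
... | inj₂ y≡z  = y≡z
... | inj₁ refl with ∈-pair⁻ {x = x} (subst (z ∈ˢ_) (sym eq) (∈-pairʳ x z))
...   | inj₁ z≡x = sym z≡x
...   | inj₂ z≡x = sym z≡x

∣pair∣≤2 : (x y : Fin n) → ∣ pair x y ∣ ≤ 2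
∣pair∣≤2 x y = ℕ.≤-trans (∣⁅x⁆∪p∣≤1+∣p∣ x ⁅ y ⁆) (s≤s (ℕ.≤-reflexive (∣⁅x⁆∣≡1 y)))

∣pair∣ : {x y : Fin n} → x ≢ y → ∣ pair x y ∣ ≡ 2
∣pair∣ {x = x} {y} x≢y = ℕ.≤-antisym (∣pair∣≤2 x y)
  (ℕ.≤-trans (unique⇒length≤ {xs = x ∷ y ∷ []} ((x≢y ∷ []) ∷ [] ∷ [])
      λ { (here refl)         → ∈-elements⁺ (pair x y) (∈-pairˡ x y)
        ; (there (here refl)) → ∈-elements⁺ (pair x y) (∈-pairʳ x y) })
    (ℕ.≤-reflexive (length-elements (pair x y))))

-- The set p itself if it has at most one element, and the empty set otherwise.
truncate : Subset n → Subset n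
truncate p with ∣ p ∣ ℕ.≤? 1
... | yes _ = p
... | no  _ = ⊥

∣truncate∣≤1 : (p : Subset n) → ∣ truncate p ∣ ≤ 1
∣truncate∣≤1 {n} p with ∣ p ∣ ℕ.≤? 1
... | yes ∣p∣≤1 = ∣p∣≤1
... | no  _     = ℕ.≤-trans (ℕ.≤-reflexive (∣⊥∣≡0 n)) z≤n

truncate-small : (p : Subset n) → ∣ p ∣ ≤ 1 → truncate p ≡ p
truncate-small p ∣p∣≤1 with ∣ p ∣ ℕ.≤? 1
... | yes _ = refl
... | no ≰1 = contradiction ∣p∣≤1 ≰1

-- Images and preimages of subsets

preimage : (Fin m → Fin n) → Subset n → Subset m
preimage f q = ⟦ (λ x → f x ∈? q) ⟧

∈-preimage⁺ : (f : Fin m → Fin n) {q : Subset n} {x : Fin m} → f x ∈ˢ q → x ∈ˢ preimage f q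
∈-preimage⁺ f {q} = ∈-⟦⟧⁺ (λ x → f x ∈? q)

∈-preimage⁻ : (f : Fin m → Fin n) {q : Subset n} {x : Fin m} → x ∈ˢ preimage f q → f x ∈ˢ q
∈-preimage⁻ f {q} = ∈-⟦⟧⁻ (λ x → f x ∈? q)

∈-image⁺ : (f : Fin m → Fin n) {p : Subset m} {x : Fin m} → x ∈ˢ p → f x ∈ˢ image f p
∈-image⁺ f {_ ∷ p} here        = x∈⁅x⁆∪p (f zero) _
∈-image⁺ f {s ∷ p} (there x∈p) = q⊆p∪q (if s then ⁅ f zero ⁆ else ⊥) _ (∈-image⁺ (f ∘ suc) x∈p)

∈-image⁻ : (f : Fin m → Fin n) (p : Subset m) {y : Fin n} →
           y ∈ˢ image f p → ∃ λ x → x ∈ˢ p × y ≡ f x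
∈-image⁻ f []          y∈ = contradiction y∈ ∉⊥
∈-image⁻ f (s ∷ p)     y∈ with x∈p∪q⁻ (if s then ⁅ f zero ⁆ else ⊥) _ y∈
∈-image⁻ f (true ∷ p)  y∈ | inj₁ y∈ˡ = zero , here , x∈⁅y⁆⇒x≡y _ y∈ˡ
∈-image⁻ f (false ∷ p) y∈ | inj₁ y∈ˡ = contradiction y∈ˡ ∉⊥
∈-image⁻ f (s ∷ p)     y∈ | inj₂ y∈ʳ
  with x , x∈p , y≡fx ← ∈-image⁻ (f ∘ suc) p y∈ʳ = suc x , there x∈p , y≡fx

image-mono : (f : Fin m → Fin n) {p q : Subset m} → p ⊆ˢ q → image f p ⊆ˢ image f q
image-mono f {p} p⊆q y∈ with x , x∈p , refl ← ∈-image⁻ f p y∈ = ∈-image⁺ f (p⊆q x∈p)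

image-preimage : (f : Fin m → Fin n) (q : Subset n) → (∀ {y} → y ∈ˢ q → ∃ λ x → y ≡ f x) →
                 image f (preimage f q) ≡ q
image-preimage f q onto = ⊆-antisym ⊆q q⊆
  where
  ⊆q : image f (preimage f q) ⊆ˢ q
  ⊆q y∈ with x , x∈ , refl ← ∈-image⁻ f (preimage f q) y∈ = ∈-preimage⁻ f x∈
  q⊆ : q ⊆ˢ image f (preimage f q)
  q⊆ y∈q with x , refl ← onto y∈q = ∈-image⁺ f (∈-preimage⁺ f y∈q)

image-reflects-∈ : (f : Fin m ↣ Fin n) (p : Subset m) {x : Fin m} →
  Injection.to f x ∈ˢ image (Injection.to f) p → x ∈ˢ p
image-reflects-∈ f p fx∈
  with x′ , x′∈p , eq ← ∈-image⁻ (Injection.to f) p fx∈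
  with refl ← Injection.injective f eq = x′∈p

image-reflects-⊆ : (f : Fin m ↣ Fin n) (p q : Subset m) →
  image (Injection.to f) p ⊆ˢ image (Injection.to f) q → p ⊆ˢ q
image-reflects-⊆ f p q fp⊆fq x∈p = image-reflects-∈ f q (fp⊆fq (∈-image⁺ (Injection.to f) x∈p))

∣image∣ : (f : Fin m ↣ Fin n) (p : Subset m) → ∣ image (Injection.to f) p ∣ ≡ ∣ p ∣
∣image∣ f p = begin
  ∣ image g p ∣                 ≡⟨ length-elements (image g p) ⟨
  length (elements (image g p)) ≡⟨ ℕ.≤-antisym
      (unique⇒length≤ (elements-unique (image g p)) image⊆map)
      (unique⇒length≤ (Unique.map⁺ (Injection.injective f) (elements-unique p)) map⊆image) ⟩
  length (map g (elements p))   ≡⟨ length-map g (elements p) ⟩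
  length (elements p)           ≡⟨ length-elements p ⟩
  ∣ p ∣                         ∎
  where
  open ≡-Reasoning
  g = Injection.to f
  image⊆map : elements (image g p) ⊆ map g (elements p)
  image⊆map y∈ with x , x∈p , refl ← ∈-image⁻ g p (∈-elements⁻ (image g p) y∈) =
    ∈-map⁺ g (∈-elements⁺ p x∈p)
  map⊆image : map g (elements p) ⊆ elements (image g p)
  map⊆image y∈ with x , x∈ , refl ← ∈-map⁻ g y∈ =
    ∈-elements⁺ (image g p) (∈-image⁺ g (∈-elements⁻ p x∈))

-- Enumeration of all r-graphs on n vertices

_≟ˢ_ : DecidableEquality (Subset n)
_≟ˢ_ = ≡-dec _≟ᵇ_

_∈ᴸ?_ : (e : Subset n) (E : List (Subset n)) → Dec (e ∈ E)
e ∈ᴸ? E = DecMembership._∈?_ _≟ˢ_ e E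

allSubsets : ∀ n → List (Subset n)
allSubsets zero    = [] ∷ []
allSubsets (suc n) = map (inside ∷_) (allSubsets n) ++ map (outside ∷_) (allSubsets n)

∈-allSubsets : (p : Subset n) → p ∈ allSubsets n
∈-allSubsets []            = here refl
∈-allSubsets (inside  ∷ p) = ∈-++⁺ˡ (∈-map⁺ (inside ∷_) (∈-allSubsets p))
∈-allSubsets (outside ∷ p) =
  ∈-++⁺ʳ (map (inside ∷_) (allSubsets _)) (∈-map⁺ (outside ∷_) (∈-allSubsets p))

allSubsets-unique : ∀ n → Unique (allSubsets n)
allSubsets-unique zero    = [] ∷ []
allSubsets-unique (suc n) = Unique.++⁺
  (Unique.map⁺ ∷-injectiveʳ (allSubsets-unique n))
  (Unique.map⁺ ∷-injectiveʳ (allSubsets-unique n)) disjoint′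
  where
  disjoint′ : ∀ {p} → ¬ (p ∈ map (inside ∷_) (allSubsets n) × p ∈ map (outside ∷_) (allSubsets n))
  disjoint′ (p∈ , p∈′)
    with _ , _ , refl ← ∈-map⁻ (inside ∷_) p∈
    with _ , _ , () ← ∈-map⁻ (outside ∷_) p∈′

subsets : ∀ r n → List (Subset n)
subsets r n = filter (λ e → ∣ e ∣ ℕ.≟ r) (allSubsets n)

∈-subsets⁺ : ∀ {r} {e : Subset n} → ∣ e ∣ ≡ r → e ∈ subsets r n
∈-subsets⁺ ∣e∣≡r = ∈-filter⁺ _ (∈-allSubsets _) ∣e∣≡r

subsets-unique : ∀ r n → Unique (subsets r n)
subsets-unique r n = Unique.filter⁺ _ (allSubsets-unique n)

∈-edges⇒∣∣≡ : ∀ {r} (H : Hypergraph r n) {e} → e ∈ edges H → ∣ e ∣ ≡ r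
∈-edges⇒∣∣≡ H = All.lookup (uniform H)

-- The r-graph whose edges are the r-sets satisfying P.
comprehension : ∀ {r} {P : Pred (Subset n) 0ℓ} → Decidable P → Hypergraph r n
comprehension {n = n} {r} P? = record
  { edges   = filter P? (subsets r n)
  ; uniform = All.tabulate λ e∈ →
      proj₂ (∈-filter⁻ (λ e → ∣ e ∣ ℕ.≟ r) {xs = allSubsets n}
        (proj₁ (∈-filter⁻ P? {xs = subsets r n} e∈)))
  ; unique  = Unique.filter⁺ P? (subsets-unique r n)
  }

module _ {r : ℕ} {P : Pred (Subset n) 0ℓ} (P? : Decidable P) where

  ∈-comprehension⁺ : ∀ {e} → ∣ e ∣ ≡ r → P e → e ∈ edges (comprehension {r = r} P?)
  ∈-comprehension⁺ ∣e∣≡r Pe = ∈-filter⁺ P? (∈-subsets⁺ ∣e∣≡r) Pe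

  ∈-comprehension⁻ : ∀ {e} → e ∈ edges (comprehension {r = r} P?) → P e
  ∈-comprehension⁻ e∈ = proj₂ (∈-filter⁻ P? {xs = subsets r n} e∈)

-- The r-graph of those members of E that have size r.
fromList : ∀ {r} → List (Subset n) → Hypergraph r n
fromList E = comprehension (_∈ᴸ? E)

-- All r-graphs on n vertices, up to the order of the edge list; by
-- hypergraphs-complete each edge set occurs.
hypergraphs : ∀ r n → List (Hypergraph r n)
hypergraphs r n = map fromList (sublists (subsets r n))

hypergraphs-complete : ∀ {r} (H : Hypergraph r n) →
  ∃ λ H′ → H′ ∈ hypergraphs r n × edges H ⊆ edges H′ × edges H′ ⊆ edges H
hypergraphs-complete {n} {r} H =
  fromList E , ∈-map⁺ fromList (filter∈sublists (_∈ᴸ? edges H) (subsets r _)) , to , from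
  where
  E : List (Subset n)
  E = edges (fromList {r = r} (edges H))
  to : edges H ⊆ edges (fromList {r = r} E)
  to {e} e∈ = ∈-comprehension⁺ (_∈ᴸ? E) ∣e∣≡r (∈-comprehension⁺ (_∈ᴸ? edges H) ∣e∣≡r e∈)
    where
    ∣e∣≡r : ∣ e ∣ ≡ r
    ∣e∣≡r = ∈-edges⇒∣∣≡ H e∈
  from : edges (fromList {r = r} E) ⊆ edges H
  from e∈ = ∈-comprehension⁻ {r = r} (_∈ᴸ? edges H) (∈-comprehension⁻ {r = r} (_∈ᴸ? E) e∈)

-- Double counting

∑-mono : {f g : Fin n → ℕ} → (∀ i → f i ≤ g i) → sum f ≤ sum g
∑-mono {zero}  f≤g = z≤n
∑-mono {suc n} f≤g = ℕ.+-mono-≤ (f≤g zero) (∑-mono (f≤g ∘ suc))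

∑-const : ∀ n c → sum {n} (λ _ → c) ≡ n * c
∑-const zero    c = refl
∑-const (suc n) c = cong (c +_) (∑-const n c)

-- The indicator function of a decided proposition.
χ : {P : Set} → Dec P → ℕ
χ P? = if does P? then 1 else 0

∑χ≡∣∣ : (p : Subset n) → sum (λ x → χ (x ∈? p)) ≡ ∣ p ∣
∑χ≡∣∣ []            = refl
∑χ≡∣∣ (inside  ∷ p) = cong suc (∑χ≡∣∣ p)
∑χ≡∣∣ (outside ∷ p) = ∑χ≡∣∣ p

module _ (g : Subset n → Subset n) where

  -- The number of members e of L, counted with multiplicity, for which x lies in
  -- g e. For g = id this is the degree of x.
  degree : List (Subset n) → Fin n → ℕ
  degree L x = length (filter (λ e → x ∈? g e) L)

  degree-∷ : ∀ e L x → degree (e ∷ L) x ≡ χ (x ∈? g e) + degree L x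
  degree-∷ e L x with does (x ∈? g e)
  ... | true  = refl
  ... | false = refl

  -- Counting the pairs of a member e of L and a vertex of g e in two ways.
  handshake : ∀ L → sum (degree L) ≡ sumᴸ (map (∣_∣ ∘ g) L)
  handshake []      = sum-replicate-zero n
  handshake (e ∷ L) = begin
    sum (degree (e ∷ L))                          ≡⟨ sum-cong-≗ (degree-∷ e L) ⟩
    sum (λ x → χ (x ∈? g e) + degree L x)         ≡⟨ ∑-distrib-+ (λ x → χ (x ∈? g e)) (degree L) ⟩
    sum (λ x → χ (x ∈? g e)) + sum (degree L)     ≡⟨ cong₂ _+_ (∑χ≡∣∣ (g e)) (handshake L) ⟩
    ∣ g e ∣ + sumᴸ (map (∣_∣ ∘ g) L) ∎
    where open ≡-Reasoning

  handshake-≤ : ∀ L c → (∀ {e} → e ∈ L → ∣ g e ∣ ≤ c) → sum (degree L) ≤ c * length L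
  handshake-≤ L c small = ℕ.≤-trans (ℕ.≤-reflexive (handshake L)) (bound L small)
    where
    bound : ∀ L → (∀ {e} → e ∈ L → ∣ g e ∣ ≤ c) → sumᴸ (map (∣_∣ ∘ g) L) ≤ c * length L
    bound []      _     = z≤n
    bound (e ∷ L) small = ℕ.≤-trans (ℕ.+-mono-≤ (small (here refl)) (bound L (small ∘ there)))
                                    (ℕ.≤-reflexive (sym (ℕ.*-suc c (length L))))

  handshake-≡ : ∀ L c → (∀ {e} → e ∈ L → ∣ g e ∣ ≡ c) → sum (degree L) ≡ c * length L
  handshake-≡ L c exact = trans (handshake L) (total L exact)
    where
    total : ∀ L → (∀ {e} → e ∈ L → ∣ g e ∣ ≡ c) → sumᴸ (map (∣_∣ ∘ g) L) ≡ c * length L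
    total []      _     = sym (ℕ.*-zeroʳ c)
    total (e ∷ L) exact = trans (cong₂ _+_ (exact (here refl)) (total L (exact ∘ there)))
                                (sym (ℕ.*-suc c (length L)))

∑-*ˡ : ∀ c (f : Fin n → ℕ) → sum (λ i → c * f i) ≡ c * sum f
∑-*ˡ {zero}  c f = sym (ℕ.*-zeroʳ c)
∑-*ˡ {suc n} c f = trans (cong (c * f zero +_) (∑-*ˡ c (f ∘ suc)))
                         (sym (ℕ.*-distribˡ-+ c (f zero) (sum (f ∘ suc))))

-- If every set of at most j + 1 vertices lies in a member of L, then for each x
-- the members containing x cover every set of at most j vertices. By induction
-- n ^ j ≤ r ^ j * degree x, and summing over x gives the bound.
covering⇒≤ : ∀ {r} j (L : List (Subset n)) → (∀ {e} → e ∈ L → ∣ e ∣ ≤ r) →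
  ((T : Subset n) → ∣ T ∣ ≤ j → ∃ λ e → e ∈ L × T ⊆ˢ e) → n ^ j ≤ r ^ j * length L
covering⇒≤ {n} zero L small cover
  with e , e∈L , _ ← cover ⊥ (ℕ.≤-reflexive (∣⊥∣≡0 n))
  = ℕ.≤-trans (∈-length e∈L) (ℕ.≤-reflexive (sym (ℕ.*-identityˡ (length L))))
covering⇒≤ {n} {r} (suc j) L small cover = begin
  n * n ^ j                              ≡⟨ ∑-const n (n ^ j) ⟨
  sum {n} (λ _ → n ^ j)                  ≤⟨ ∑-mono link ⟩
  sum (λ x → r ^ j * degree id L x)      ≡⟨ ∑-*ˡ (r ^ j) (degree id L) ⟩
  r ^ j * sum (degree id L)              ≤⟨ ℕ.*-monoʳ-≤ (r ^ j) (handshake-≤ id L r small) ⟩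
  r ^ j * (r * length L)                 ≡⟨ ℕ.*-assoc (r ^ j) r (length L) ⟨
  r ^ j * r * length L                   ≡⟨ cong (_* length L) (ℕ.*-comm (r ^ j) r) ⟩
  r * r ^ j * length L                   ∎
  where
  open ℕ.≤-Reasoning
  link : ∀ x → n ^ j ≤ r ^ j * degree id L x
  link x = covering⇒≤ j (filter (x ∈?_) L)
    (λ e∈ → small (proj₁ (∈-filter⁻ (x ∈?_) {xs = L} e∈)))
    λ T ∣T∣≤j →
      let e , e∈L , xT⊆e = cover (⁅ x ⁆ ∪ T) (ℕ.≤-trans (∣⁅x⁆∪p∣≤1+∣p∣ x T) (s≤s ∣T∣≤j)) in
      e , ∈-filter⁺ (x ∈?_) e∈L (xT⊆e (x∈⁅x⁆∪p x T)) , λ y∈T → xT⊆e (q⊆p∪q ⁅ x ⁆ T y∈T)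

-- Cliques, obstructed edge sets and the family of obstructions

module Construction (r : ℕ) (2≤r : 2 ≤ r) where

  -- The argument for sat-nonmultiple needs k > r. The value r + 1 would do there,
  -- but for graphs the comparison of constants is made with k = 4.
  k : ℕ
  k = 2 + r

  -- A complete k-set of the r-graph with edge list E.
  Clique : List (Subset n) → Subset n → Set
  Clique E Q = ∣ Q ∣ ≡ k × (∀ {e} → ∣ e ∣ ≡ r → e ⊆ˢ Q → e ∈ E)

  -- The vertex x lies in a clique.
  Covered : List (Subset n) → Fin n → Set
  Covered E x = ∃ λ Q → Clique E Q × x ∈ˢ Q

  -- Some edge e whose vertices are all covered meets a clique Q but is not
  -- contained in Q. Being phrased with existing cliques and edges only, this is
  -- preserved by adding edges and by passing to a larger r-graph.
  Obstructed : List (Subset n) → Set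
  Obstructed E = ∃ λ e → e ∈ E × (∀ {x} → x ∈ˢ e → Covered E x) ×
    ∃ λ Q → Clique E Q × (∃ λ x → x ∈ˢ e × x ∈ˢ Q) × ¬ (e ⊆ˢ Q)

  clique? : (E : List (Subset n)) → Decidable (Clique E)
  clique? E Q = (∣ Q ∣ ℕ.≟ k) ×-dec
    map′ (λ ∄ {e} ∣e∣≡r e⊆Q → decidable-stable (e ∈ᴸ? E) λ e∉E →
            ∄ (e , ∣e∣≡r , (λ {x} → e⊆Q {x}) , e∉E))
         (λ { all (e , ∣e∣≡r , e⊆Q , e∉E) → e∉E (all ∣e∣≡r e⊆Q) })
         (¬? (anySubset? λ e → (∣ e ∣ ℕ.≟ r) ×-dec (e ⊆? Q) ×-dec ¬? (e ∈ᴸ? E)))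

  covered? : (E : List (Subset n)) → Decidable (Covered E)
  covered? E x = anySubset? λ Q → clique? E Q ×-dec (x ∈? Q)

  obstructed? : Decidable (Obstructed {n})
  obstructed? E = anySubset? λ e → (e ∈ᴸ? E) ×-dec
    map′ (λ all {x} → all x) (λ all x → all {x}) (all? λ x → (x ∈? e) →-dec covered? E x) ×-dec
    anySubset? λ Q → clique? E Q ×-dec any? (λ x → (x ∈? e) ×-dec (x ∈? Q)) ×-dec ¬? (e ⊆? Q)

  clique-mono : {E E′ : List (Subset n)} {Q : Subset n} → E ⊆ E′ → Clique E Q → Clique E′ Q
  clique-mono E⊆E′ (∣Q∣≡k , complete) = ∣Q∣≡k , λ ∣e∣≡r e⊆Q → E⊆E′ (complete ∣e∣≡r e⊆Q)

  obstructed-mono : {E E′ : List (Subset n)} → E ⊆ E′ → Obstructed E → Obstructed E′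
  obstructed-mono E⊆E′ (e , e∈E , cov , Q , clq , meets , e⊈Q) =
    e , E⊆E′ e∈E , (λ x∈e → let Q , clq , x∈Q = cov x∈e in Q , clique-mono E⊆E′ clq , x∈Q) ,
    Q , clique-mono E⊆E′ clq , meets , e⊈Q

  module _ (f : Fin m ↣ Fin n) where
    private g = Injection.to f

    module _ {E : List (Subset m)} {E′ : List (Subset n)}
             (copy : ∀ {e} → e ∈ E → image g e ∈ E′) where

      clique-image : ∀ {Q} → Clique E Q → Clique E′ (image g Q)
      clique-image {Q} (∣Q∣≡k , complete) = trans (∣image∣ f Q) ∣Q∣≡k , complete′
        where
        complete′ : ∀ {e} → ∣ e ∣ ≡ r → e ⊆ˢ image g Q → e ∈ E′
        complete′ {e} ∣e∣≡r e⊆ = subst (_∈ E′) e₀↦e (copy (complete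
          (trans (sym (∣image∣ f e₀)) (trans (cong ∣_∣ e₀↦e) ∣e∣≡r))
          (λ x∈e₀ → image-reflects-∈ f Q (e⊆ (∈-preimage⁻ g x∈e₀)))))
          where
          e₀ = preimage g e
          e₀↦e : image g e₀ ≡ e
          e₀↦e = image-preimage g e λ y∈e → let x , _ , y≡gx = ∈-image⁻ g Q (e⊆ y∈e) in x , y≡gx

      obstructed-image : Obstructed E → Obstructed E′
      obstructed-image (e , e∈E , cov , Q , clq , (x , x∈e , x∈Q) , e⊈Q) =
        image g e , copy e∈E , cov′ ,
        image g Q , clique-image clq , (g x , ∈-image⁺ g x∈e , ∈-image⁺ g x∈Q) ,
        λ ge⊆gQ → e⊈Q (image-reflects-⊆ f e Q ge⊆gQ)
        where
        cov′ : ∀ {y} → y ∈ˢ image g e → Covered E′ y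
        cov′ y∈ with x , x∈e , refl ← ∈-image⁻ g e y∈ with Q , clq , x∈Q ← cov x∈e =
          image g Q , clique-image clq , ∈-image⁺ g x∈Q

    -- The r-graph that an injection f of vertex sets induces from E.
    pullback : List (Subset n) → Hypergraph r m
    pullback E = comprehension λ e → image g e ∈ᴸ? E

    module _ {E : List (Subset n)} where

      clique-preimage : ∀ {Q} → Clique E Q → (∀ {y} → y ∈ˢ Q → ∃ λ x → y ≡ g x) →
                        Clique (edges (pullback E)) (preimage g Q)
      clique-preimage {Q} (∣Q∣≡k , complete) onto =
        trans (sym (∣image∣ f (preimage g Q))) (trans (cong ∣_∣ (image-preimage g Q onto)) ∣Q∣≡k) ,
        λ {e} ∣e∣≡r e⊆ → ∈-comprehension⁺ (λ e → image g e ∈ᴸ? E) ∣e∣≡r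
          (complete (trans (∣image∣ f e) ∣e∣≡r) (image⊆ e⊆))
        where
        image⊆ : ∀ {e} → e ⊆ˢ preimage g Q → image g e ⊆ˢ Q
        image⊆ {e} e⊆ y∈ with x , x∈e , refl ← ∈-image⁻ g e y∈ = ∈-preimage⁻ g (e⊆ x∈e)

  -- One clique for each vertex of xs; ys lists the vertices of these cliques.
  collect : (E : List (Subset n)) (xs : List (Fin n)) → (∀ {x} → x ∈ xs → Covered E x) →
    ∃ λ ys → length ys ≤ length xs * k ×
      (∀ {x} → x ∈ xs → ∃ λ Q → Clique E Q × x ∈ˢ Q × (∀ {y} → y ∈ˢ Q → y ∈ ys))
  collect E []       cov = [] , z≤n , λ ()
  collect E (x ∷ xs) cov
    with ys , ∣ys∣≤ , cov′ ← collect E xs (cov ∘ there)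
    with Q , clq@(∣Q∣≡k , _) , x∈Q ← cov (here refl) =
    elements Q ++ ys ,
    ℕ.≤-trans (ℕ.≤-reflexive (length-++ (elements Q)))
      (ℕ.+-mono-≤ (ℕ.≤-reflexive (trans (length-elements Q) ∣Q∣≡k)) ∣ys∣≤) ,
    λ { (here refl)  → Q , clq , x∈Q , λ y∈Q → ∈-++⁺ˡ (∈-elements⁺ Q y∈Q)
      ; (there x∈xs) → let Q′ , clq′ , x∈Q′ , Q′⊆ys = cov′ x∈xs in
          Q′ , clq′ , x∈Q′ , λ y∈Q′ → ∈-++⁺ʳ (elements Q) (Q′⊆ys y∈Q′) }

  -- An obstruction of H survives on the vertex set of the clique Q together with
  -- one clique for each of the r vertices of e, which is at most r + 1 cliques.
  localise : (H : Hypergraph r n) → Obstructed (edges H) →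
    ∃ λ m → m ≤ suc r * k × ∃ λ (f : Fin m ↣ Fin n) → Obstructed (edges (pullback f (edges H)))
  localise {n} H (e , e∈E , cov , Q , clq@(∣Q∣≡k , _) , (x , x∈e , x∈Q) , e⊈Q)
    with ys , ∣ys∣≤ , cov′ ← collect (edges H) (elements e) (cov ∘ ∈-elements⁻ e) =
    length support , ∣support∣≤ , f ,
    preimage g e ,
    ∈-comprehension⁺ (λ e → image g e ∈ᴸ? E) ∣e₀∣≡r (subst (_∈ E) (sym e₀↦e) e∈E) ,
    (λ x∈ → let Q′ , clq′ , x∈Q′ , Q′⊆ys = cov′ (∈-elements⁺ e (∈-preimage⁻ g x∈)) in
       preimage g Q′ , clique-preimage f clq′ (onto ∘ ys⊆ ∘ Q′⊆ys) , ∈-preimage⁺ g x∈Q′) ,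
    preimage g Q , clique-preimage f clq (onto ∘ Q⊆) ,
    (let i , x≡gi = onto (Q⊆ x∈Q) in
      i , ∈-preimage⁺ g (subst (_∈ˢ e) x≡gi x∈e) , ∈-preimage⁺ g (subst (_∈ˢ Q) x≡gi x∈Q)) ,
    λ e₀⊆Q₀ → e⊈Q λ y∈e → let i , y≡gi = onto (e⊆ y∈e) in
      subst (_∈ˢ Q) (sym y≡gi) (∈-preimage⁻ g (e₀⊆Q₀ (∈-preimage⁺ g (subst (_∈ˢ e) y≡gi y∈e))))
    where
    E = edges H
    -- Without repetitions, so that looking up a position is injective.
    support = deduplicate _≟ᶠ_ (elements Q ++ ys)

    f : Fin (length support) ↣ Fin n
    f = mk↣ (lookup-injective (deduplicate-! _≟ᶠ_ (elements Q ++ ys)))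
    g = Injection.to f

    onto : ∀ {y} → y ∈ support → ∃ λ i → y ≡ g i
    onto y∈ = index y∈ , lookup-index y∈

    Q⊆ : ∀ {y} → y ∈ˢ Q → y ∈ support
    Q⊆ y∈Q = ∈-deduplicate⁺ _≟ᶠ_ (∈-++⁺ˡ (∈-elements⁺ Q y∈Q))

    ys⊆ : ∀ {y} → y ∈ ys → y ∈ support
    ys⊆ y∈ys = ∈-deduplicate⁺ _≟ᶠ_ (∈-++⁺ʳ (elements Q) y∈ys)

    e⊆ : ∀ {y} → y ∈ˢ e → y ∈ support
    e⊆ y∈e = let _ , _ , y∈Q′ , Q′⊆ys = cov′ (∈-elements⁺ e y∈e) in ys⊆ (Q′⊆ys y∈Q′)

    e₀↦e : image g (preimage g e) ≡ e
    e₀↦e = image-preimage g e (onto ∘ e⊆)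

    ∣e₀∣≡r : ∣ preimage g e ∣ ≡ r
    ∣e₀∣≡r = trans (sym (∣image∣ f (preimage g e))) (trans (cong ∣_∣ e₀↦e) (∈-edges⇒∣∣≡ H e∈E))

    ∣support∣≤ : length support ≤ suc r * k
    ∣support∣≤ = begin
      length support                      ≤⟨ length-deduplicate _≟ᶠ_ (elements Q ++ ys) ⟩
      length (elements Q ++ ys)           ≡⟨ length-++ (elements Q) ⟩
      length (elements Q) + length ys     ≤⟨ ℕ.+-mono-≤
        (ℕ.≤-reflexive (trans (length-elements Q) ∣Q∣≡k)) ∣ys∣≤ ⟩
      k + length (elements e) * k         ≡⟨ cong (λ s → k + s * k)
        (trans (length-elements e) (∈-edges⇒∣∣≡ H e∈E)) ⟩
      k + r * k                           ∎
      where open ℕ.≤-Reasoning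

  -- All r-graphs on at most (r + 1) k vertices.
  candidates : Family r
  candidates = concatMap (λ m → map (m ,_) (hypergraphs r m)) (upTo (suc (suc r * k)))

  obstruction? : (F : ∃ (Hypergraph r)) → Dec (Obstructed (edges (proj₂ F)))
  obstruction? F = obstructed? (edges (proj₂ F))

  -- The family of the theorem: the obstructed candidates.
  𝓕 : Family r
  𝓕 = filter obstruction? candidates

  contains⇒obstructed : (H : Hypergraph r n) → ∀ {F} → F ∈ 𝓕 → proj₂ F ⊑ H → Obstructed (edges H)
  contains⇒obstructed H F∈𝓕 (f , copy) =
    obstructed-image f copy (proj₂ (∈-filter⁻ obstruction? {xs = candidates} F∈𝓕))

  obstructed⇒contains : (H : Hypergraph r n) → Obstructed (edges H) → ∃ λ F → F ∈ 𝓕 × proj₂ F ⊑ H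
  obstructed⇒contains H obs
    with m , m≤ , f , obs₀ ← localise H obs
    with F , F∈ , ⊆F , F⊆ ← hypergraphs-complete (pullback f (edges H)) =
    (m , F) ,
    ∈-filter⁺ obstruction?
      (∈-concatMap⁺ (λ m → map (m ,_) (hypergraphs r m))
        (lose (∈-upTo⁺ (s≤s m≤)) (∈-map⁺ (m ,_) F∈)))
      (obstructed-mono ⊆F obs₀) ,
    f , λ e∈F → ∈-comprehension⁻ {r = r} (λ e → image (Injection.to f) e ∈ᴸ? edges H) (F⊆ e∈F)

-- Saturated hypergraphs and the saturation number

  -- No r-set can be added to E without creating an obstruction.
  Maximal : List (Subset n) → Set
  Maximal E = ∀ {e} → ∣ e ∣ ≡ r → e ∉ E → Obstructed (e ∷ E)

  -- Saturation expressed by obstructions instead of copies of members of the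
  -- family. In this form it is plainly decidable.
  Extremal : Hypergraph r n → Set
  Extremal H = ¬ Obstructed (edges H) × Maximal (edges H)

  extremal? : Decidable (Extremal {n})
  extremal? H = ¬? (obstructed? E) ×-dec
    map′ (λ ∄ {e} ∣e∣≡r e∉E → decidable-stable (obstructed? (e ∷ E)) λ ¬obs →
            ∄ (e , ∣e∣≡r , e∉E , ¬obs))
         (λ { max (e , ∣e∣≡r , e∉E , ¬obs) → ¬obs (max ∣e∣≡r e∉E) })
         (¬? (anySubset? λ e → (∣ e ∣ ℕ.≟ r) ×-dec ¬? (e ∈ᴸ? E) ×-dec ¬? (obstructed? (e ∷ E))))
    where E = edges H

  extremal⇒saturated : {H : Hypergraph r n} → Extremal H → Saturated 𝓕 H
  extremal⇒saturated {H = H} (¬obs , max) = record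
    { free    = λ F∈𝓕 F⊑H → ¬obs (contains⇒obstructed H F∈𝓕 F⊑H)
    ; maximal = λ e ∣e∣≡r e∉H → obstructed⇒contains (addEdge H e ∣e∣≡r e∉H) (max ∣e∣≡r e∉H)
    }

  saturated⇒extremal : {H : Hypergraph r n} → Saturated 𝓕 H → Extremal H
  saturated⇒extremal {H = H} H-sat =
    (λ obs → let F , F∈𝓕 , F⊑H = obstructed⇒contains H obs in free F∈𝓕 F⊑H) ,
    (λ {e} ∣e∣≡r e∉H → let F , F∈𝓕 , F⊑H+e = maximal e ∣e∣≡r e∉H in
       contains⇒obstructed (addEdge H e ∣e∣≡r e∉H) F∈𝓕 F⊑H+e)
    where open Saturated H-sat

  maximal-resp : {E E′ : List (Subset n)} → E ⊆ E′ → E′ ⊆ E → Maximal E → Maximal E′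
  maximal-resp E⊆E′ E′⊆E max ∣e∣≡r e∉E′ =
    obstructed-mono (λ { (here eq) → here eq ; (there e∈) → there (E⊆E′ e∈) })
      (max ∣e∣≡r (e∉E′ ∘ E⊆E′))

  module _ (n : ℕ) where

    emptyHypergraph : Hypergraph r n
    emptyHypergraph = record { edges = [] ; uniform = [] ; unique = [] }

    unobstructed? : Decidable (λ (H : Hypergraph r n) → ¬ Obstructed (edges H))
    unobstructed? H = ¬? (obstructed? (edges H))

    -- Only the stated properties of largest and sparsest matter below, hence opaque.
    opaque
      -- An unobstructed r-graph with the most edges is extremal, so extremal
      -- r-graphs exist on every number of vertices.
      largest : Hypergraph r n
      largest = argmax ∥_∥ emptyHypergraph (filter unobstructed? (hypergraphs r n))

      largest-extremal : Extremal largest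
      largest-extremal = ¬obs , max
        where
        ¬obs : ¬ Obstructed (edges largest)
        ¬obs = argmax-all ∥_∥ {P = λ H → ¬ Obstructed (edges H)} (λ { (_ , () , _) })
          (all-filter unobstructed? (hypergraphs r n))

        max : Maximal (edges largest)
        max {e} ∣e∣≡r e∉ = decidable-stable (obstructed? (e ∷ edges largest)) λ ¬obs′ →
          let H = addEdge largest e ∣e∣≡r e∉
              H′ , H′∈ , H⊆H′ , H′⊆H = hypergraphs-complete H
              H′∈′ = ∈-filter⁺ unobstructed? H′∈ (¬obs′ ∘ obstructed-mono H′⊆H)
          in contradiction
               (ℕ.≤-trans (unique⇒length≤ (unique H) H⊆H′)
                          (argmax-greatest ∥_∥ emptyHypergraph
                            (filter unobstructed? (hypergraphs r n)) H′∈′))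
               ℕ.1+n≰n

    opaque
      -- An extremal r-graph with the fewest edges.
      sparsest : Hypergraph r n
      sparsest = argmin ∥_∥ largest (filter extremal? (hypergraphs r n))

      sparsest-extremal : Extremal sparsest
      sparsest-extremal = argmin-all ∥_∥ {P = Extremal} largest-extremal
        (all-filter extremal? (hypergraphs r n))

      sparsest-minimum : (H : Hypergraph r n) → Extremal H → ∥ sparsest ∥ ≤ ∥ H ∥
      sparsest-minimum H (¬obs , max) =
        let H′ , H′∈ , H⊆H′ , H′⊆H = hypergraphs-complete H in
        ℕ.≤-trans {j = ∥ H′ ∥}
          (argmin-least ∥_∥ largest (filter extremal? (hypergraphs r n))
            (∈-filter⁺ extremal? H′∈ (¬obs ∘ obstructed-mono H′⊆H , maximal-resp H⊆H′ H′⊆H max)))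
          (unique⇒length≤ (unique H′) H′⊆H)

    sat : ℕ
    sat = ∥ sparsest ∥

    sat-isSaturationNumber : IsSaturationNumber 𝓕 n sat
    sat-isSaturationNumber = record
      { attained = sparsest , extremal⇒saturated {H = sparsest} sparsest-extremal , refl
      ; minimum  = λ H H-sat → sparsest-minimum H (saturated⇒extremal H-sat)
      }

  -- Two vertices of a k-set lie in a common r-subset of it, because 2 ≤ r ≤ k.
  interpolate-pair : {Q : Subset n} {x y : Fin n} → ∣ Q ∣ ≡ k → x ∈ˢ Q → y ∈ˢ Q →
                     ∃ λ e → x ∈ˢ e × y ∈ˢ e × e ⊆ˢ Q × ∣ e ∣ ≡ r
  interpolate-pair {Q = Q} {x} {y} ∣Q∣≡k x∈Q y∈Q
    with e , xy⊆e , e⊆Q , ∣e∣≡r ← interpolate {p = pair x y} {Q} {r} (pair⊆ x∈Q y∈Q)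
           (ℕ.≤-trans (∣pair∣≤2 x y) 2≤r)
           (ℕ.≤-trans (ℕ.m≤n+m r 2) (ℕ.≤-reflexive (sym ∣Q∣≡k)))
    = e , xy⊆e (∈-pairˡ x y) , xy⊆e (∈-pairʳ x y) , e⊆Q , ∣e∣≡r

  cliques-disjoint : {E : List (Subset n)} {P Q : Subset n} {x : Fin n} → ¬ Obstructed E →
    Clique E P → Clique E Q → x ∈ˢ P → x ∈ˢ Q → P ≡ Q
  cliques-disjoint {E = E} ¬obs P-clq Q-clq x∈P x∈Q =
    ⊆-antisym (within P-clq Q-clq x∈P x∈Q) (within Q-clq P-clq x∈Q x∈P)
    where
    within : ∀ {P Q x} → Clique E P → Clique E Q → x ∈ˢ P → x ∈ˢ Q → P ⊆ˢ Q
    within {P} {Q} {x} P-clq@(∣P∣≡k , complete) Q-clq x∈P x∈Q {y} y∈P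
      with e , x∈e , y∈e , e⊆P , ∣e∣≡r ← interpolate-pair ∣P∣≡k x∈P y∈P
      = decidable-stable (y ∈? Q) λ y∉Q → ¬obs
          (e , complete ∣e∣≡r e⊆P , (λ z∈e → P , P-clq , e⊆P z∈e) ,
           Q , Q-clq , (x , x∈e , x∈Q) , λ e⊆Q → y∉Q (e⊆Q y∈e))

-- Disjoint cliques: few edges when the order is a multiple of k

  -- The vertices of Fin (q * k) are split into q blocks of size k, and the edges
  -- are the r-sets contained in a block.
  module DisjointCliques (q : ℕ) where

    blockEmbedding : Fin q → Fin k ↣ Fin (q * k)
    blockEmbedding b = mk↣ {to = combine b} (λ {i} {j} → combine-injectiveʳ b i b j)

    -- The b-th block of k vertices.
    block : Fin q → Subset (q * k)
    block b = image (combine b) ⊤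

    ∈-block : ∀ x → ∃ λ b → x ∈ˢ block b
    ∈-block x with b , i , refl ← combine-surjective {q} {k} x = b , ∈-image⁺ (combine b) ∈⊤

    block-unique : ∀ {x b c} → x ∈ˢ block b → x ∈ˢ block c → b ≡ c
    block-unique {x} {b} {c} x∈b x∈c
      with i , _ , refl ← ∈-image⁻ (combine b) ⊤ x∈b
      with j , _ , eq ← ∈-image⁻ (combine c) ⊤ x∈c = combine-injectiveˡ b i c j eq

    blockEdges : Fin q → List (Subset (q * k))
    blockEdges b = map (image (combine b)) (subsets r k)

    -- The disjoint union of q cliques.
    H : Hypergraph r (q * k)
    H = fromList (concatMap blockEdges (allFin q))

    ∈-H⁺ : ∀ {e b} → ∣ e ∣ ≡ r → e ⊆ˢ block b → e ∈ edges H
    ∈-H⁺ {e} {b} ∣e∣≡r e⊆ = ∈-comprehension⁺ (_∈ᴸ? concatMap blockEdges (allFin q)) ∣e∣≡r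
      (∈-concatMap⁺ blockEdges (lose (∈-allFin b)
        (subst (_∈ blockEdges b) e₀↦e (∈-map⁺ (image (combine b)) (∈-subsets⁺ {e = e₀} ∣e₀∣≡r)))))
      where
      e₀ = preimage (combine b) e
      e₀↦e : image (combine b) e₀ ≡ e
      e₀↦e = image-preimage (combine b) e λ y∈e →
        let i , _ , y≡ = ∈-image⁻ (combine b) ⊤ (e⊆ y∈e) in i , y≡
      ∣e₀∣≡r : ∣ e₀ ∣ ≡ r
      ∣e₀∣≡r = trans (sym (∣image∣ (blockEmbedding b) e₀)) (trans (cong ∣_∣ e₀↦e) ∣e∣≡r)

    ∈-H⁻ : ∀ {e} → e ∈ edges H → ∃ λ b → e ⊆ˢ block b
    ∈-H⁻ e∈H
      with b , _ , e∈b ← find (∈-concatMap⁻ blockEdges {xs = allFin q}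
        (∈-comprehension⁻ {r = r} (_∈ᴸ? concatMap blockEdges (allFin q)) e∈H))
      with e₀ , _ , refl ← ∈-map⁻ (image (combine b)) e∈b = b , image-mono (combine b) {e₀} ⊆⊤

    block-clique : ∀ b → Clique (edges H) (block b)
    block-clique b = trans (∣image∣ (blockEmbedding b) ⊤) (∣⊤∣≡n k) , ∈-H⁺

    -- Any two vertices of a clique lie in a common edge, so in a common block:
    -- there are no cliques other than the blocks.
    clique⊆block : ∀ {Q x b} → Clique (edges H) Q → x ∈ˢ Q → x ∈ˢ block b → Q ⊆ˢ block b
    clique⊆block {Q} {x} {b} (∣Q∣≡k , complete) x∈Q x∈b {y} y∈Q
      with e , x∈e , y∈e , e⊆Q , ∣e∣≡r ← interpolate-pair ∣Q∣≡k x∈Q y∈Q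
      with c , e⊆c ← ∈-H⁻ (complete ∣e∣≡r e⊆Q)
      with refl ← block-unique x∈b (e⊆c x∈e) = e⊆c y∈e

    extremal : Extremal H
    extremal = ¬obs , max
      where
      ¬obs : ¬ Obstructed (edges H)
      ¬obs (e , e∈H , _ , Q , clq@(∣Q∣≡k , _) , (x , x∈e , x∈Q) , e⊈Q)
        with b , e⊆b ← ∈-H⁻ e∈H
        with refl ← ⊆∧∣∣≥⇒≡ (clique⊆block clq x∈Q (e⊆b x∈e))
                      (ℕ.≤-reflexive (trans (proj₁ (block-clique b)) (sym ∣Q∣≡k)))
        = e⊈Q e⊆b

      max : Maximal (edges H)
      max {e} ∣e∣≡r e∉H
        with x , x∈e , _ ← ∣∣<⇒∃∉ {p = ⊥} {e}
          (ℕ.≤-trans (s≤s (ℕ.≤-reflexive (∣⊥∣≡0 (q * k))))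
            (ℕ.≤-trans (ℕ.≤-trans (s≤s z≤n) 2≤r) (ℕ.≤-reflexive (sym ∣e∣≡r))))
        with b , x∈b ← ∈-block x
        = e , here refl ,
          (λ {y} _ → let c , y∈c = ∈-block y in
             block c , clique-mono there (block-clique c) , y∈c) ,
          block b , clique-mono there (block-clique b) , (x , x∈e , x∈b) ,
          λ e⊆b → e∉H (∈-H⁺ ∣e∣≡r e⊆b)

    length-blocks : ∀ bs → length (concatMap blockEdges bs) ≡ length bs * length (subsets r k)
    length-blocks []       = refl
    length-blocks (b ∷ bs) = trans (length-++ (blockEdges b))
      (cong₂ _+_ (length-map (image (combine b)) (subsets r k)) (length-blocks bs))

    ∥H∥≤ : ∥ H ∥ ≤ q * length (subsets r k)
    ∥H∥≤ = begin
      ∥ H ∥                                        ≤⟨ unique⇒length≤ (unique H)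
        (∈-comprehension⁻ {r = r} (_∈ᴸ? concatMap blockEdges (allFin q))) ⟩
      length (concatMap blockEdges (allFin q))     ≡⟨ length-blocks (allFin q) ⟩
      length (allFin q) * length (subsets r k)     ≡⟨ cong (_* length (subsets r k))
        (length-tabulate {n = q} id) ⟩
      q * length (subsets r k)                     ∎
      where open ℕ.≤-Reasoning

  sat-multiple : ∀ q → sat (q * k) ≤ q * length (subsets r k)
  sat-multiple q =
    ℕ.≤-trans {j = ∥ H ∥} (sparsest-minimum (q * k) H extremal) ∥H∥≤
    where open DisjointCliques q

  sat-multiple-linear : ∀ n → k ∣ n → sat n ≤ length (subsets r k) * n
  sat-multiple-linear n (divides q refl) = begin
    sat (q * k)                    ≤⟨ sat-multiple q ⟩
    q * length (subsets r k)       ≡⟨ ℕ.*-comm q (length (subsets r k)) ⟩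
    length (subsets r k) * q       ≤⟨ ℕ.*-monoʳ-≤ (length (subsets r k)) (ℕ.m≤m*n q k) ⟩
    length (subsets r k) * (q * k) ∎
    where open ℕ.≤-Reasoning

-- An uncovered vertex: many edges when the order is not a multiple of k

  -- The cliques partition the vertices: each vertex has degree 1 in the list of
  -- cliques, and the handshake identity reads n = k * number of cliques.
  allCovered⇒∣ : {E : List (Subset n)} → ¬ Obstructed E → (∀ x → Covered E x) → k ∣ n
  allCovered⇒∣ {n} {E} ¬obs covered = divides (length cliques) (begin
    n                      ≡⟨ ℕ.*-identityʳ n ⟨
    n * 1                  ≡⟨ ∑-const n 1 ⟨
    sum {n} (λ _ → 1)      ≡⟨ sum-cong-≗ degree≡1 ⟨
    sum (degree id cliques) ≡⟨ handshake-≡ id cliques k (λ Q∈ → proj₁ (∈-cliques⁻ Q∈)) ⟩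
    k * length cliques     ≡⟨ ℕ.*-comm k (length cliques) ⟩
    length cliques * k     ∎)
    where
    open ≡-Reasoning
    cliques = filter (clique? E) (allSubsets n)
    ∈-cliques⁻ : ∀ {Q} → Q ∈ cliques → Clique E Q
    ∈-cliques⁻ Q∈ = proj₂ (∈-filter⁻ (clique? E) {xs = allSubsets n} Q∈)

    degree≡1 : ∀ x → degree id cliques x ≡ 1
    degree≡1 x with Q , clq , x∈Q ← covered x = ℕ.≤-antisym
      (unique⇒length≤ {ys = Q ∷ []}
        (Unique.filter⁺ (x ∈?_) (Unique.filter⁺ (clique? E) (allSubsets-unique n)))
        λ P∈ → let P∈cliques , x∈P = ∈-filter⁻ (x ∈?_) {xs = cliques} P∈ in
          here (cliques-disjoint ¬obs (∈-cliques⁻ P∈cliques) clq x∈P x∈Q))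
      (unique⇒length≤ {xs = Q ∷ []} ([] ∷ [])
        λ { (here refl) → ∈-filter⁺ (x ∈?_) (∈-filter⁺ (clique? E) (∈-allSubsets Q) clq) x∈Q })

  ∤⇒uncovered : {E : List (Subset n)} → ¬ Obstructed E → k ∤ n → ∃ λ v → ¬ Covered E v
  ∤⇒uncovered {n} {E} ¬obs k∤n =
    ¬∀⟶∃¬ n (Covered E) (covered? E) λ covered → k∤n (allCovered⇒∣ ¬obs covered)

  -- A saturated r-graph with an uncovered vertex v.
  module Uncovered {H : Hypergraph r n} (H-extremal : Extremal H)
                   {v : Fin n} (v-uncovered : ¬ Covered (edges H) v) where

    E = edges H

    -- Adding a missing edge e through v completes a clique. Otherwise all cliques
    -- of E + e are cliques of E; then e cannot cause an obstruction, since v is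
    -- still uncovered, and an older edge cannot either, since E is unobstructed.
    completes-clique : ∀ {e} → ∣ e ∣ ≡ r → v ∈ˢ e → e ∉ E → ∃ λ K → Clique (e ∷ E) K × e ⊆ˢ K
    completes-clique {e} ∣e∣≡r v∈e e∉E =
      decidable-stable (anySubset? λ K → clique? (e ∷ E) K ×-dec (e ⊆? K)) λ ∄K →
        ¬obstructed ∄K (proj₂ H-extremal ∣e∣≡r e∉E)
      where
      module _ (∄K : ¬ ∃ λ K → Clique (e ∷ E) K × e ⊆ˢ K) where

        old-clique : ∀ {Q} → Clique (e ∷ E) Q → Clique E Q
        old-clique {Q} clq = proj₁ clq , λ ∣e′∣≡r e′⊆Q → old-edge e′⊆Q (proj₂ clq ∣e′∣≡r e′⊆Q)
          where
          old-edge : ∀ {e′} → e′ ⊆ˢ Q → e′ ∈ e ∷ E → e′ ∈ E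
          old-edge e⊆Q (here refl)  = contradiction (Q , clq , λ {x} → e⊆Q {x}) ∄K
          old-edge _   (there e′∈E) = e′∈E

        old-covered : ∀ {x} → Covered (e ∷ E) x → Covered E x
        old-covered (Q , clq , x∈Q) = Q , old-clique clq , x∈Q

        ¬obstructed : ¬ Obstructed (e ∷ E)
        ¬obstructed (_ , here refl , cov , _) = v-uncovered (old-covered (cov v∈e))
        ¬obstructed (e′ , there e′∈E , cov , Q , clq , meets , e′⊈Q) = proj₁ H-extremal
          (e′ , e′∈E , (λ x∈e′ → old-covered (cov x∈e′)) , Q , old-clique clq , meets , e′⊈Q)

    ∣⁅x⁆∪T∣≤r : (x : Fin n) (T : Subset n) → ∣ T ∣ ≤ r ∸ 1 → ∣ ⁅ x ⁆ ∪ T ∣ ≤ r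
    ∣⁅x⁆∪T∣≤r x T ∣T∣≤r-1 = ℕ.≤-trans (∣⁅x⁆∪p∣≤1+∣p∣ x T)
      (ℕ.≤-trans (s≤s ∣T∣≤r-1) (ℕ.≤-reflexive (ℕ.m+[n∸m]≡n (ℕ.≤-trans (s≤s z≤n) 2≤r))))

    -- If the r-set e containing v and T is missing, it lies in a clique K of E + e.
    -- An r-subset of K that contains T and a vertex w outside e differs from e,
    -- hence is an edge of E.
    small⊆edge : r ≤ n → (T : Subset n) → ∣ T ∣ ≤ r ∸ 1 → ∃ λ e → e ∈ E × T ⊆ˢ e
    small⊆edge r≤n T ∣T∣≤r-1
      with e , vT⊆e , _ , ∣e∣≡r ← interpolate {p = ⁅ v ⁆ ∪ T} {⊤} ⊆⊤
        (∣⁅x⁆∪T∣≤r v T ∣T∣≤r-1) (ℕ.≤-trans r≤n (ℕ.≤-reflexive (sym (∣⊤∣≡n n))))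
      with T⊆e ← (λ {x} x∈T → vT⊆e {x} (q⊆p∪q ⁅ v ⁆ T x∈T))
      with e ∈ᴸ? E
    ... | yes e∈E = e , e∈E , T⊆e
    ... | no  e∉E
      with K , (∣K∣≡k , complete) , e⊆K ← completes-clique ∣e∣≡r (vT⊆e (x∈⁅x⁆∪p v T)) e∉E
      with w , w∈K , w∉e ← ∣∣<⇒∃∉ {p = e} {K}
             (subst₂ _<_ (sym ∣e∣≡r) (sym ∣K∣≡k) (ℕ.m≤n+m (suc r) 1))
      with e′ , wT⊆e′ , e′⊆K , ∣e′∣≡r ← interpolate {p = ⁅ w ⁆ ∪ T} {K} {r}
             (⁅x⁆∪p⊆q w∈K (λ x∈T → e⊆K (T⊆e x∈T)))
             (∣⁅x⁆∪T∣≤r w T ∣T∣≤r-1) (ℕ.≤-trans (ℕ.m≤n+m r 2) (ℕ.≤-reflexive (sym ∣K∣≡k)))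
      with complete ∣e′∣≡r e′⊆K
    ... | here refl  = contradiction (wT⊆e′ (x∈⁅x⁆∪p w T)) w∉e
    ... | there e′∈E = e′ , e′∈E , λ x∈T → wT⊆e′ (q⊆p∪q ⁅ w ⁆ T x∈T)

  sat-nonmultiple : ∀ n → r ≤ n → k ∤ n → n ^ (r ∸ 1) ≤ r ^ (r ∸ 1) * sat n
  sat-nonmultiple n r≤n k∤n
    with v , v-uncovered ← ∤⇒uncovered (proj₁ (sparsest-extremal n)) k∤n
    = covering⇒≤ (r ∸ 1) (edges (sparsest n))
        (λ e∈ → ℕ.≤-reflexive (∈-edges⇒∣∣≡ (sparsest n) e∈))
        (Uncovered.small⊆edge {H = sparsest n} (sparsest-extremal n) v-uncovered r≤n)

-- Graphs: the constants along multiples and non-multiples of 4 differ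

module Graph where
  open Construction 2 ℕ.≤-refl

  module _ (H : Hypergraph 2 n) where

    adjacent? : (x y : Fin n) → Dec (pair x y ∈ edges H)
    adjacent? x y = pair x y ∈ᴸ? edges H

    -- The neighbourhood of x. It omits x itself, as pair x x is not of size 2.
    N : Fin n → Subset n
    N x = ⟦ adjacent? x ⟧

    ∣N∣≤degree : ∀ x → ∣ N x ∣ ≤ degree id (edges H) x
    ∣N∣≤degree x = begin
      ∣ N x ∣                                ≡⟨ length-elements (N x) ⟨
      length (elements (N x))                ≡⟨ length-map (pair x) (elements (N x)) ⟨
      length (map (pair x) (elements (N x))) ≤⟨ unique⇒length≤
        (Unique.map⁺ (pair-injective x) (elements-unique (N x))) incident ⟩
      degree id (edges H) x                  ∎
      where
      open ℕ.≤-Reasoning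
      incident : map (pair x) (elements (N x)) ⊆ filter (x ∈?_) (edges H)
      incident e∈ with y , y∈ , refl ← ∈-map⁻ (pair x) e∈ =
        ∈-filter⁺ (x ∈?_) (∈-⟦⟧⁻ (adjacent? x) (∈-elements⁻ (N x) y∈)) (∈-pairˡ x y)

    ∑∣N∣≤ : sum (λ x → ∣ N x ∣) ≤ 2 * ∥ H ∥
    ∑∣N∣≤ = ℕ.≤-trans (∑-mono ∣N∣≤degree)
      (handshake-≤ id (edges H) 2 (λ e∈ → ℕ.≤-reflexive (∈-edges⇒∣∣≡ H e∈)))

    clique⊆⁅u⁆∪N : ∀ {Q u} → Clique (edges H) Q → u ∈ˢ Q → Q ⊆ˢ ⁅ u ⁆ ∪ N u
    clique⊆⁅u⁆∪N {Q} {u} (_ , complete) u∈Q {w} w∈Q with w ≟ᶠ u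
    ... | yes refl = x∈⁅x⁆∪p u (N u)
    ... | no  w≢u  = q⊆p∪q ⁅ u ⁆ (N u)
      (∈-⟦⟧⁺ (adjacent? u) (complete (∣pair∣ (w≢u ∘ sym)) (pair⊆ u∈Q w∈Q)))

    -- A covered vertex u has three neighbours in its clique, and v is a further
    -- neighbour if it is adjacent to u, because v lies in no clique.
    ∣N∣-covered : ∀ {v} → ¬ Covered (edges H) v → ∀ {u} → Covered (edges H) u →
                  3 + χ (u ∈? N v) ≤ ∣ N u ∣
    ∣N∣-covered {v} v-uncov {u} (Q , clq@(∣Q∣≡4 , _) , u∈Q) with u ∈? N v
    ... | no _ = s≤s⁻¹ (begin
      4               ≡⟨ ∣Q∣≡4 ⟨
      ∣ Q ∣           ≤⟨ p⊆q⇒∣p∣≤∣q∣ (clique⊆⁅u⁆∪N clq u∈Q) ⟩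
      ∣ ⁅ u ⁆ ∪ N u ∣ ≤⟨ ∣⁅x⁆∪p∣≤1+∣p∣ u (N u) ⟩
      suc ∣ N u ∣     ∎)
      where open ℕ.≤-Reasoning
    ... | yes u∈Nv = s≤s⁻¹ (begin
      5               ≡⟨ cong suc ∣Q∣≡4 ⟨
      suc ∣ Q ∣       ≤⟨ p⊂q⇒∣p∣<∣q∣ (clique⊆⁅u⁆∪N clq u∈Q , v , q⊆p∪q ⁅ u ⁆ (N u) v∈Nu , v∉Q) ⟩
      ∣ ⁅ u ⁆ ∪ N u ∣ ≤⟨ ∣⁅x⁆∪p∣≤1+∣p∣ u (N u) ⟩
      suc ∣ N u ∣     ∎)
      where
      open ℕ.≤-Reasoning
      v∈Nu : v ∈ˢ N u
      v∈Nu = ∈-⟦⟧⁺ (adjacent? u) (subst (_∈ edges H) (pair-comm v u) (∈-⟦⟧⁻ (adjacent? v) u∈Nv))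
      v∉Q : v ∉ˢ Q
      v∉Q v∈Q = v-uncov (Q , clq , v∈Q)

    -- The case in which every uncovered vertex has degree at least n / 8,
    -- which is at least 4 for 32 ≤ n.
    dense : 32 ≤ n → (∀ v → ¬ Covered (edges H) v → n ≤ 8 * ∣ N v ∣) →
            ∀ {v} → ¬ Covered (edges H) v → 25 * n ≤ 16 * ∥ H ∥
    dense 32≤n large {v} v-uncov = begin
      25 * n                       ≡⟨ solve 1 (λ n →
        con 25 :* n := con 8 :* (n :* con 3) :+ n) refl n ⟩
      8 * (n * 3) + n              ≤⟨ ℕ.+-monoʳ-≤ (8 * (n * 3)) (large v v-uncov) ⟩
      8 * (n * 3) + 8 * ∣ N v ∣    ≡⟨ ℕ.*-distribˡ-+ 8 (n * 3) ∣ N v ∣ ⟨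
      8 * (n * 3 + ∣ N v ∣)        ≡⟨ cong (8 *_) (cong₂ _+_ (∑-const n 3) (∑χ≡∣∣ (N v))) ⟨
      8 * (sum {n} (λ _ → 3) + sum (λ u → χ (u ∈? N v)))
        ≡⟨ cong (8 *_) (∑-distrib-+ (λ _ → 3) (λ u → χ (u ∈? N v))) ⟨
      8 * sum (λ u → 3 + χ (u ∈? N v)) ≤⟨ ℕ.*-monoʳ-≤ 8 (∑-mono bound) ⟩
      8 * sum (λ u → ∣ N u ∣)      ≤⟨ ℕ.*-monoʳ-≤ 8 ∑∣N∣≤ ⟩
      8 * (2 * ∥ H ∥)              ≡⟨ ℕ.*-assoc 8 2 ∥ H ∥ ⟨
      16 * ∥ H ∥                   ∎
      where
      open ℕ.≤-Reasoning
      χ≤1 : ∀ u → χ (u ∈? N v) ≤ 1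
      χ≤1 u with does (u ∈? N v)
      ... | true  = s≤s z≤n
      ... | false = z≤n
      bound : ∀ u → 3 + χ (u ∈? N v) ≤ ∣ N u ∣
      bound u with covered? (edges H) u
      ... | yes u-cov   = ∣N∣-covered v-uncov u-cov
      ... | no  u-uncov = ℕ.≤-trans (ℕ.+-monoʳ-≤ 3 (χ≤1 u))
        (ℕ.*-cancelˡ-≤ 8 (ℕ.≤-trans 32≤n (large u u-uncov)))

  -- The case of an uncovered vertex v of small degree: each vertex that is far
  -- from v sends two edges into the neighbourhood of v, and these edges are
  -- distinct for distinct far vertices.
  module Sparse {H : Hypergraph 2 n} (H-extremal : Extremal H)
                {v : Fin n} (v-uncovered : ¬ Covered (edges H) v) where
    open Uncovered {H = H} H-extremal v-uncovered

    far? : Decidable (λ w → w ≢ v × w ∉ˢ N H v)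
    far? w = ¬? (w ≟ᶠ v) ×-dec ¬? (w ∈? N H v)

    -- The vertices other than v that are not adjacent to v.
    far : Subset n
    far = ⟦ far? ⟧

    -- The far end of an edge with at most one far vertex. Truncating makes sure
    -- that no edge is counted twice in 2∣far∣≤.
    farEnd : Subset n → Subset n
    farEnd e = truncate (e ∩ far)

    ∈-farEnd : ∀ {w a} → w ∈ˢ far → a ∈ˢ N H v → w ∈ˢ farEnd (pair w a)
    ∈-farEnd {w} {a} w∈far a∈N = subst (w ∈ˢ_) (sym (truncate-small (pair w a ∩ far)
      (ℕ.≤-trans (p⊆q⇒∣p∣≤∣q∣ ⊆⁅w⁆) (ℕ.≤-reflexive (∣⁅x⁆∣≡1 w))))) (x∈p∩q⁺ (∈-pairˡ w a , w∈far))
      where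
      ⊆⁅w⁆ : pair w a ∩ far ⊆ˢ ⁅ w ⁆
      ⊆⁅w⁆ z∈ with z∈pair , z∈far ← x∈p∩q⁻ (pair w a) far z∈ with ∈-pair⁻ {x = w} z∈pair
      ... | inj₁ refl = x∈⁅x⁆ w
      ... | inj₂ refl = contradiction a∈N (proj₂ (∈-⟦⟧⁻ far? z∈far))

    -- The missing edge vw completes a clique with two further vertices a and b, and
    -- these are adjacent to both v and w.
    two-links : ∀ {w} → w ∈ˢ far → 2 ≤ length (filter (λ e → w ∈? farEnd e) E)
    two-links {w} w∈far
      with w≢v , w∉N ← ∈-⟦⟧⁻ far? w∈far
      with K , (∣K∣≡4 , complete) , e⊆K ← completes-clique (∣pair∣ (w≢v ∘ sym)) (∈-pairˡ v w)
             (w∉N ∘ ∈-⟦⟧⁺ (adjacent? H v))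
      with a , a∈K , a∉ ← ∣∣<⇒∃∉ {p = pair v w} {K}
             (ℕ.≤-trans (s≤s (∣pair∣≤2 v w)) (ℕ.≤-trans (ℕ.n≤1+n 3) (ℕ.≤-reflexive (sym ∣K∣≡4))))
      with b , b∈K , b∉ ← ∣∣<⇒∃∉ {p = ⁅ a ⁆ ∪ pair v w} {K}
             (ℕ.≤-trans (s≤s (ℕ.≤-trans (∣⁅x⁆∪p∣≤1+∣p∣ a (pair v w)) (s≤s (∣pair∣≤2 v w))))
               (ℕ.≤-reflexive (sym ∣K∣≡4)))
      = unique⇒length≤ {xs = pair w a ∷ pair w b ∷ []}
          ((a≢b ∘ pair-injective w ∷ []) ∷ [] ∷ [])
          λ { (here refl)         → link a∈K a∉
            ; (there (here refl)) → link b∈K (b∉ ∘ q⊆p∪q ⁅ a ⁆ (pair v w)) }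
      where
      a≢b : a ≢ b
      a≢b refl = b∉ (x∈⁅x⁆∪p a (pair v w))
      old : ∀ {x z} → x ∈ˢ pair v w → z ∈ˢ K → z ∉ˢ pair v w → pair x z ∈ E
      old {x} {z} x∈vw z∈K z∉
        with complete (∣pair∣ {x = x} {z} λ { refl → z∉ x∈vw }) (pair⊆ (e⊆K x∈vw) z∈K)
      ... | there xz∈E = xz∈E
      ... | here eq    = contradiction (subst (z ∈ˢ_) eq (∈-pairʳ x z)) z∉
      link : ∀ {z} → z ∈ˢ K → z ∉ˢ pair v w → pair w z ∈ filter (λ e → w ∈? farEnd e) E
      link z∈K z∉ = ∈-filter⁺ (λ e → w ∈? farEnd e) (old (∈-pairʳ v w) z∈K z∉)
        (∈-farEnd w∈far (∈-⟦⟧⁺ (adjacent? H v) (old (∈-pairˡ v w) z∈K z∉)))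

    2∣far∣≤ : 2 * ∣ far ∣ ≤ ∥ H ∥
    2∣far∣≤ = begin
      2 * ∣ far ∣                              ≡⟨ cong (2 *_) (∑χ≡∣∣ far) ⟨
      2 * sum (λ w → χ (w ∈? far))             ≡⟨ ∑-*ˡ 2 (λ w → χ (w ∈? far)) ⟨
      sum (λ w → 2 * χ (w ∈? far))             ≤⟨ ∑-mono bound ⟩
      sum (degree farEnd E)                    ≤⟨ handshake-≤ farEnd E 1
        (λ {e} _ → ∣truncate∣≤1 (e ∩ far)) ⟩
      1 * ∥ H ∥                                ≡⟨ ℕ.*-identityˡ ∥ H ∥ ⟩
      ∥ H ∥                                    ∎
      where
      open ℕ.≤-Reasoning
      bound : ∀ w → 2 * χ (w ∈? far) ≤ degree farEnd E w
      bound w with w ∈? far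
      ... | yes w∈far = two-links w∈far
      ... | no  _     = z≤n

    n≤1+∣N∣+∣far∣ : n ≤ 1 + (∣ N H v ∣ + ∣ far ∣)
    n≤1+∣N∣+∣far∣ = begin
      n                              ≡⟨ ∣⊤∣≡n n ⟨
      ∣ ⊤ {n} ∣                      ≤⟨ p⊆q⇒∣p∣≤∣q∣ cover ⟩
      ∣ ⁅ v ⁆ ∪ (N H v ∪ far) ∣      ≤⟨ ∣⁅x⁆∪p∣≤1+∣p∣ v (N H v ∪ far) ⟩
      1 + ∣ N H v ∪ far ∣            ≤⟨ s≤s (∣p∪q∣≤∣p∣+∣q∣ (N H v) far) ⟩
      1 + (∣ N H v ∣ + ∣ far ∣)      ∎
      where
      open ℕ.≤-Reasoning
      cover : ⊤ {n} ⊆ˢ ⁅ v ⁆ ∪ (N H v ∪ far)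
      cover {w} _ with w ≟ᶠ v | w ∈? N H v
      ... | yes refl | _       = x∈⁅x⁆∪p v _
      ... | no  _    | yes w∈N = q⊆p∪q ⁅ v ⁆ _ (p⊆p∪q far w∈N)
      ... | no  w≢v  | no  w∉N = q⊆p∪q ⁅ v ⁆ _ (q⊆p∪q (N H v) far (∈-⟦⟧⁺ far? (w≢v , w∉N)))

    sparse : 32 ≤ n → 8 * ∣ N H v ∣ ≤ n → 25 * n ≤ 16 * ∥ H ∥
    sparse 32≤n small = ℕ.≤-trans (ℕ.*-monoˡ-≤ n (ℕ.m≤m+n 25 2))
      (ℕ.+-cancelʳ-≤ (n + 4 * n) (27 * n) (16 * ∥ H ∥) (begin
        27 * n + (n + 4 * n)              ≡⟨ solve 1 (λ n →
          con 27 :* n :+ (n :+ con 4 :* n) := con 32 :* n) refl n ⟩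
        32 * n                            ≤⟨ ℕ.*-monoʳ-≤ 32 n≤1+∣N∣+∣far∣ ⟩
        32 * (1 + (d + f))                ≡⟨ solve 2 (λ d f →
          con 32 :* (con 1 :+ (d :+ f)) :=
          con 16 :* (con 2 :* f) :+ (con 32 :+ con 4 :* (con 8 :* d))) refl d f ⟩
        16 * (2 * f) + (32 + 4 * (8 * d)) ≤⟨ ℕ.+-mono-≤ (ℕ.*-monoʳ-≤ 16 2∣far∣≤)
          (ℕ.+-mono-≤ 32≤n (ℕ.*-monoʳ-≤ 4 small)) ⟩
        16 * ∥ H ∥ + (n + 4 * n)          ∎))
      where
      open ℕ.≤-Reasoning
      d = ∣ N H v ∣
      f = ∣ far ∣

  sat-graph-nonmultiple : ∀ n → 32 ≤ n → 4 ∤ n → 25 * n ≤ 16 * sat n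
  sat-graph-nonmultiple n 32≤n 4∤n
    with any? (λ v → ¬? (covered? (edges (sparsest n)) v) ×-dec (8 * ∣ N (sparsest n) v ∣ ℕ.≤? n))
  ... | yes (v , v-uncov , small) =
    Sparse.sparse {H = sparsest n} (sparsest-extremal n) v-uncov 32≤n small
  ... | no  ∄ with v , v-uncov ← ∤⇒uncovered (proj₁ (sparsest-extremal n)) 4∤n =
    dense (sparsest n) 32≤n
      (λ u u-uncov → ℕ.≰⇒≥ λ small → ∄ (u , u-uncov , small)) v-uncov

  -- A clique on 4 vertices has 6 edges.
  sat-graph-multiple : ∀ n → 4 ∣ n → 16 * sat n ≤ 24 * n
  sat-graph-multiple n (divides q refl) = begin
    16 * sat (q * 4)  ≤⟨ ℕ.*-monoʳ-≤ 16 (sat-multiple q) ⟩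
    16 * (q * 6)      ≡⟨ solve 1 (λ q → con 16 :* (q :* con 6) := con 24 :* (q :* con 4)) refl q ⟩
    24 * (q * 4)      ∎
    where open ℕ.≤-Reasoning

-- Non-convergence

-- Comparison of fractions by cross multiplication.
/-<⇒*<* : ∀ a b c d .{{_ : NonZero b}} .{{d≢0 : NonZero d}} →
          (ℤ.+ a) ℚ./ b ℚ.< (ℤ.+ c) ℚ./ d → a * d < c * b
/-<⇒*<* a b@(suc b-1) c d@(suc d-1) p<q
  with ℚᵘ.*<* ad<cb ← ℚᵘ.<-respʳ-≃ (ℚ.toℚᵘ-fromℚᵘ (ℚᵘ.mkℚᵘ (ℤ.+ c) d-1))
                        (ℚᵘ.<-respˡ-≃ (ℚ.toℚᵘ-fromℚᵘ (ℚᵘ.mkℚᵘ (ℤ.+ a) b-1)) (ℚ.toℚᵘ-mono-< p<q))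
  = ℤ.drop‿+<+ (subst₂ ℤ._<_ (sym (ℤ.pos-* a d)) (sym (ℤ.pos-* c b)) ad<cb)

*<*⇒/-< : ∀ a b c d .{{_ : NonZero b}} .{{d≢0 : NonZero d}} →
          a * d < c * b → (ℤ.+ a) ℚ./ b ℚ.< (ℤ.+ c) ℚ./ d
*<*⇒/-< a b@(suc b-1) c d@(suc d-1) ad<cb = ℚ.toℚᵘ-cancel-<
  (ℚᵘ.<-respʳ-≃ (ℚᵘ.≃-sym (ℚ.toℚᵘ-fromℚᵘ (ℚᵘ.mkℚᵘ (ℤ.+ c) d-1)))
    (ℚᵘ.<-respˡ-≃ (ℚᵘ.≃-sym (ℚ.toℚᵘ-fromℚᵘ (ℚᵘ.mkℚᵘ (ℤ.+ a) b-1)))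
      (ℚᵘ.*<* (subst₂ ℤ._<_ (ℤ.pos-* a d) (ℤ.pos-* c b) (ℤ.+<+ ad<cb)))))

-- P holds for arbitrarily large positive integers. The shift by one matches the
-- indexing of ratio.
Frequently : Pred ℕ 0ℓ → Set
Frequently P = ∀ N → ∃ λ i → N ≤ i × P (suc i)

-- If s n / n ^ l is infinitely often at most P / D and infinitely often at least
-- Q / D, then a limit x has to satisfy P / D < x or x < Q / D by locatedness,
-- and either is contradicted by infinitely many terms.
oscillating⇒¬convergent : ∀ (s : ℕ → ℕ) l D P Q .{{_ : NonZero D}} → P < Q →
  Frequently (λ n → D * s n ≤ P * n ^ l) → Frequently (λ n → Q * n ^ l ≤ D * s n) →
  ¬ Convergent (ratio s l)
oscillating⇒¬convergent s l D P Q P<Q often-small often-large (x , below , above)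
  with located x ((ℤ.+ P) ℚ./ D) ((ℤ.+ Q) ℚ./ D) (*<*⇒/-< P D Q D (ℕ.*-monoˡ-< D P<Q))
... | inj₁ p<x
  with N , eventually ← below ((ℤ.+ P) ℚ./ D) p<x
  with i , N≤i , small ← often-small N
  = contradiction small (ℕ.<⇒≱ (ℕ.<-≤-trans
      (/-<⇒*<* P D (s (suc i)) (suc i ^ l) {{d≢0 = ℕ.m^n≢0 (suc i) l}} (eventually i N≤i))
      (ℕ.≤-reflexive (ℕ.*-comm (s (suc i)) D))))
... | inj₂ x<q
  with N , eventually ← above ((ℤ.+ Q) ℚ./ D) x<q
  with i , N≤i , large ← often-large N
  = contradiction large (ℕ.<⇒≱ (ℕ.≤-<-trans
      (ℕ.≤-reflexive (ℕ.*-comm D (s (suc i))))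
      (/-<⇒*<* (s (suc i)) (suc i ^ l) Q D {{ℕ.m^n≢0 (suc i) l}} (eventually i N≤i))))

module _ (k : ℕ) (2≤k : 2 ≤ k) where

  often-multiple : {P : Pred ℕ 0ℓ} (M : ℕ) → (∀ n → M ≤ n → k ∣ n → P n) → Frequently P
  often-multiple {P} M holds N = i , ℕ.≤-trans (ℕ.m≤m+n N M) L≤i ,
    subst P (sym 1+i≡) (holds (suc L * k) M≤ (n∣m*n (suc L)))
    where
    instance _ = >-nonZero (ℕ.≤-trans (s≤s z≤n) 2≤k)
    L = N + M
    -- The multiple suc L * k is positive, so it is the successor of some i.
    i = pred (suc L * k)
    1+i≡ : suc i ≡ suc L * k
    1+i≡ = ℕ.suc-pred (suc L * k) {{ℕ.m*n≢0 (suc L) k}}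
    L≤i : L ≤ i
    L≤i = s≤s⁻¹ (ℕ.≤-trans (ℕ.m≤m*n (suc L) k) (ℕ.≤-reflexive (sym 1+i≡)))
    M≤ : M ≤ suc L * k
    M≤ = ℕ.≤-trans (ℕ.m≤n+m M N) (ℕ.≤-trans (ℕ.n≤1+n L) (ℕ.m≤m*n (suc L) k))

  often-nonmultiple : {P : Pred ℕ 0ℓ} (M : ℕ) → (∀ n → M ≤ n → k ∤ n → P n) → Frequently P
  often-nonmultiple M holds N = L * k , ℕ.≤-trans (ℕ.m≤m+n N M) L≤Lk ,
    holds (suc (L * k)) (ℕ.≤-trans (ℕ.m≤n+m M N) (ℕ.≤-trans L≤Lk (ℕ.n≤1+n (L * k))))
      λ k∣1+Lk → ℕ.<⇒≱ 2≤k (∣⇒≤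
        (∣m+n∣m⇒∣n (subst (k ∣_) (sym (ℕ.+-comm (L * k) 1)) k∣1+Lk) (n∣m*n L)))
    where
    instance _ = >-nonZero (ℕ.≤-trans (s≤s z≤n) 2≤k)
    L = N + M
    L≤Lk : L ≤ L * k
    L≤Lk = ℕ.m≤m*n L k

  -- For d ≥ 2, a linear upper bound along the multiples of k and a lower bound of
  -- order n ^ d along the other integers. For l = 1 the ratio is at most A along the
  -- multiples but unbounded along the others. For l ≥ 2 it tends to 0 along the
  -- multiples but is at least 1 / B along the others.
  bounds⇒¬convergent : ∀ (s : ℕ → ℕ) d A B → 2 ≤ d → .{{_ : NonZero B}} →
    (∀ n → k ∣ n → s n ≤ A * n) → ∀ N → (∀ n → N ≤ n → k ∤ n → n ^ d ≤ B * s n) →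
    ∀ l → 1 ≤ l → l ≤ d → ¬ Convergent (ratio s l)
  bounds⇒¬convergent s d A B 2≤d upper N lower 1 _ _ =
    oscillating⇒¬convergent s 1 1 A (suc A) ℕ.≤-refl
    (often-multiple 0 λ n _ k∣n → begin
      1 * s n       ≡⟨ ℕ.*-identityˡ (s n) ⟩
      s n           ≤⟨ upper n k∣n ⟩
      A * n         ≡⟨ cong (A *_) (ℕ.^-identityʳ n) ⟨
      A * n ^ 1     ∎)
    -- For n > B (A + 1), the lower bound n * n ≤ B * s n gives B (A + 1) n ≤ B * s n.
    (often-nonmultiple (N + suc (B * suc A)) λ n large k∤n →
      let instance _ = >-nonZero (ℕ.≤-trans (s≤s z≤n) (ℕ.m+n≤o⇒n≤o N large)) in
      ℕ.*-cancelˡ-≤ B (begin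
        B * (suc A * n ^ 1) ≡⟨ cong (λ x → B * (suc A * x)) (ℕ.^-identityʳ n) ⟩
        B * (suc A * n)     ≡⟨ ℕ.*-assoc B (suc A) n ⟨
        B * suc A * n       ≤⟨ ℕ.*-monoˡ-≤ n (ℕ.≤-trans (ℕ.n≤1+n _) (ℕ.m+n≤o⇒n≤o N large)) ⟩
        n * n               ≡⟨ cong (n *_) (ℕ.^-identityʳ n) ⟨
        n ^ 2               ≤⟨ ℕ.^-monoʳ-≤ n {2} {d} 2≤d ⟩
        n ^ d               ≤⟨ lower n (ℕ.m+n≤o⇒m≤o N large) k∤n ⟩
        B * s n             ≡⟨ cong (B *_) (ℕ.*-identityˡ (s n)) ⟨
        B * (1 * s n)       ∎))
    where open ℕ.≤-Reasoning
  bounds⇒¬convergent s d A B 2≤d upper N lower l@(suc (suc l-2)) _ l≤d =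
    oscillating⇒¬convergent s l (2 * B) 1 2 {{ℕ.m*n≢0 2 B}} ℕ.≤-refl
    -- For n > 2 B A, the upper bound 2 B A n is at most n * n.
    (often-multiple (suc (2 * B * A)) λ n large k∣n →
      let instance _ = >-nonZero (ℕ.≤-trans (s≤s z≤n) large) in begin
      2 * B * s n     ≤⟨ ℕ.*-monoʳ-≤ (2 * B) (upper n k∣n) ⟩
      2 * B * (A * n) ≡⟨ ℕ.*-assoc (2 * B) A n ⟨
      2 * B * A * n   ≤⟨ ℕ.*-monoˡ-≤ n (ℕ.≤-trans (ℕ.n≤1+n _) large) ⟩
      n * n           ≡⟨ cong (n *_) (ℕ.^-identityʳ n) ⟨
      n ^ 2           ≤⟨ ℕ.^-monoʳ-≤ n {2} {l} (s≤s (s≤s z≤n)) ⟩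
      n ^ l           ≡⟨ ℕ.*-identityˡ (n ^ l) ⟨
      1 * n ^ l       ∎)
    -- The summand 1 makes n positive, as monotonicity of n ^ l in l needs.
    (often-nonmultiple (N + 1) λ n large k∤n →
      let instance _ = >-nonZero (ℕ.m+n≤o⇒n≤o N large) in begin
      2 * n ^ l       ≤⟨ ℕ.*-monoʳ-≤ 2 (ℕ.^-monoʳ-≤ n l≤d) ⟩
      2 * n ^ d       ≤⟨ ℕ.*-monoʳ-≤ 2 (lower n (ℕ.m+n≤o⇒m≤o N large) k∤n) ⟩
      2 * (B * s n)   ≡⟨ ℕ.*-assoc 2 B (s n) ⟨
      2 * B * s n     ∎)
    where open ℕ.≤-Reasoning

-- For l = 1 the ratio is at most 24 / 16 along the multiples of 4 and at least
-- 25 / 16 along the other large integers.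
graph-oscillates : ∀ l → 1 ≤ l → l ≤ 1 → ¬ Convergent (ratio (Construction.sat 2 ℕ.≤-refl) l)
graph-oscillates (suc zero) _ (s≤s z≤n) = oscillating⇒¬convergent sat 1 16 24 25 ℕ.≤-refl
  (often-multiple 4 (s≤s (s≤s z≤n)) 0 λ n _ 4∣n → begin
      16 * sat n  ≤⟨ Graph.sat-graph-multiple n 4∣n ⟩
      24 * n      ≡⟨ cong (24 *_) (ℕ.^-identityʳ n) ⟨
      24 * n ^ 1  ∎)
  (often-nonmultiple 4 (s≤s (s≤s z≤n)) 32 λ n 32≤n 4∤n → begin
      25 * n ^ 1  ≡⟨ cong (25 *_) (ℕ.^-identityʳ n) ⟩
      25 * n      ≤⟨ Graph.sat-graph-nonmultiple n 32≤n 4∤n ⟩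
      16 * sat n  ∎)
  where
  open Construction 2 ℕ.≤-refl
  open ℕ.≤-Reasoning

sat-oscillates : ∀ r (2≤r : 2 ≤ r) l → 1 ≤ l → l ≤ r ∸ 1 →
                 ¬ Convergent (ratio (Construction.sat r 2≤r) l)
sat-oscillates (suc (suc zero)) (s≤s (s≤s z≤n)) = graph-oscillates
sat-oscillates r@(suc (suc (suc _))) 2≤r =
  bounds⇒¬convergent k (s≤s (s≤s z≤n)) sat (r ∸ 1) (length (subsets r k)) (r ^ (r ∸ 1))
    (s≤s (s≤s z≤n)) {{ℕ.m^n≢0 r (r ∸ 1)}} sat-multiple-linear r sat-nonmultiple
  where
  open Construction r 2≤r

theorem3 : ∀ (r : ℕ) → 2 ≤ r →
    Σ (Family r) λ 𝓕 → Σ ℕ λ k → Σ (ℕ → ℕ) λ sat →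
    2 ≤ k
    × (∀ n → IsSaturationNumber 𝓕 n (sat n))
    × BigO (λ n → k ∣ n) sat (λ n → n)
    × BigΩ (λ n → k ∤ n) sat (λ n → n ^ (r ∸ 1))
    × (∀ l → 1 ≤ l → l ≤ r ∸ 1 → ¬ Convergent (ratio sat l))
theorem3 r 2≤r = 𝓕 , k , sat , s≤s (s≤s z≤n) , sat-isSaturationNumber ,
  (length (subsets r k) , 0 , λ n _ → sat-multiple-linear n) ,
  (r ^ (r ∸ 1) , r , sat-nonmultiple) ,
  sat-oscillates r 2≤r
  where
  open Construction r 2≤r
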